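{- Let $N$ be a lattice, let $\sigma\subset N_{\mathbb R}$ be a strongly convex rational polyhedral cone, let $\Delta$ be a rational simplicial subdivision of $\sigma$, and let $v_1,\ldots,v_s$ be the primitive generators of the rays of $\Delta$. Suppose $\lambda\in\Delta$ is contained in every maximal cone of $\Delta$. Then \[ (1-x^{v_1})\cdots(1-x^{v_s})\cdot G_\sigma \;=\; H_{\operatorname{lk}\lambda}+\sum_{\tau\in\Delta,\ \tau\succeq\lambda}\Bigl(B_{\tau,\lambda}\cdot H_{\operatorname{lk}\tau}\cdot\prod_{v_j\notin\operatorname{Star}\tau}(1-x^{v_j})\Bigr). \]
   Context: $\mathbb Z[N]$ is the Laurent polynomial ring of $N$ with monomials $x^v$, $v\in N$; $G_\sigma=\sum_{v\in\sigma\cap N}x^v$. $\tau\succeq\lambda$ means $\lambda$ is a face of $\tau$. For a cone $\gamma$, "$v_i\in\gamma$" means $v_i$ generates a ray of $\gamma$. The link $\operatorname{lk}\tau$ is the set of cones $\gamma\in\Delta$ with $\gamma\cap\tau=0$ and $\gamma+\tau\in\Delta$; $v_j\in\operatorname{lk}\tau$ means $v_j$ generates a ray of some cone of $\operatorname{lk}\tau$, and $H_{\operatorname{lk}\tau}=\sum_{\gamma\in\operatorname{lk}\tau}\bigl(\prod_{v_i\in\gamma}x^{v_i}\cdot\prod_{v_j\in\operatorname{lk}\tau,\,v_j\notin\gamma}(1-x^{v_j})\bigr)$. $\operatorname{Star}\tau$ is the union of the maximal cones of $\Delta$ containing $\tau$; $v_j\notin\operatorname{Star}\tau$ means $v_j$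 generates no ray of such a cone. For $\tau\in\Delta$ spanned by $v_1,\ldots,v_r$ and its face $\lambda$ spanned by $v_1,\ldots,v_q$ (after renumbering, $q\le r$), $\operatorname{Box}(\tau,\lambda)=\{a_1v_1+\cdots+a_rv_r : 0\le a_i<1\text{ for all }i,\ a_i\ne0\text{ for }i>q\}$ and $B_{\tau,\lambda}=\sum_{v\in\operatorname{Box}(\tau,\lambda)\cap N}x^v$.
   Formalization: As printed, the identity counts the origin of Box(λ,λ) twice (N=ℤ, σ=ℝ≥0, λ=0 gives 1=2); here B_{τ,λ} sums over the nonzero lattice points of Box(τ,λ), which is the same as dropping the summand H_{lk λ}. -}

module Defs where

open import Data.Bool.Base using (Bool; true; false; _∨_; if_then_else_)
import Data.Bool.Properties as Bool
open import Data.Fin.Base using (Fin; zero; suc)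
open import Data.Fin.Subset using (Subset; ⊤; ⊥; ⁅_⁆; _∈_; _∉_; _⊆_; _∩_; _∪_)
open import Data.Fin.Subset.Properties using (_∈?_; _⊆?_)
open import Data.Integer.Base as ℤ using (ℤ; 0ℤ; 1ℤ; -1ℤ)
import Data.Integer.Properties as ℤ
open import Data.List.Base using (List; []; _∷_; _++_; [_]; map; foldr; filter; concat; allFin; cartesianProductWith)
open import Data.List.Membership.Propositional using () renaming (_∈_ to _∈ˡ_)
import Data.List.Membership.DecPropositional as DecMembership
import Data.List.Membership.Propositional.Properties as List
open import Data.List.Relation.Unary.All as All using (All; []; _∷_)
import Data.List.Relation.Unary.All.Properties as All
open import Data.List.Relation.Unary.Any using (Any; here; there; any?)
open import Data.List.Relation.Unary.Unique.Propositional using (Unique)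
open import Data.Nat.Base using (ℕ; zero; suc)
open import Data.Product.Base using (∃; _×_; _,_; proj₁; proj₂)
open import Data.Rational.Base as ℚ using (ℚ; 0ℚ; 1ℚ; _+_; _*_; -_; _-_; 1/_; _≤_; _<_; Positive; Negative)
import Data.Rational.Properties as ℚ
open import Data.Rational.Solver using (module +-*-Solver)
open import Data.Sum.Base using (_⊎_; inj₁; inj₂)
open import Data.Vec.Base using (Vec; lookup; replicate; zipWith) renaming (map to mapᵛ)
import Data.Vec.Properties as Vec
open import Data.Vec.Functional using (Vector) renaming (_∷_ to _∷ᶠ_)
open import Function.Base using (_∘_; id)
open import Function.Bundles using (_⇔_; mk⇔; Equivalence)
open import Relation.Binary.Definitions using (DecidableEquality; tri<; tri≈; tri>)
open import Relation.Binary.PropositionalEquality using (_≡_; _≢_; _≗_; refl; sym; trans; cong; subst; subst₂; setoid; module ≡-Reasoning)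
open import Relation.Nullary using (Dec; yes; no; ¬_; does; contradiction; ¬?; _×-dec_; _→-dec_; map′)
open import Relation.Unary using (Pred; Decidable)
import Algebra.Bundles
open import Algebra.Properties.Semiring.Sum (Algebra.Bundles.CommutativeRing.semiring ℚ.+-*-commutativeRing) using (sum; sum-cong-≗; *-distribˡ-sum; ∑-distrib-+)
open import Level using (0ℓ)

open Equivalence using (to; from)
open +-*-Solver using (solve; _:=_; _:+_; _:*_; :-_; con)

private
  variable
    k m n s : ℕ

------------------------------------------------------------------------
-- Decidability of systems of strict and non-strict linear inequalities
-- over ℚ, by Fourier–Motzkin elimination.  It is used only to make the
-- coefficients of generating functions of lattice points well defined.

private
  infix 4 _≲[_]_
  _≲[_]_ : ℚ → Bool → ℚ → Set
  p ≲[ false ] q = p ≤ q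
  p ≲[ true ]  q = p < q

  Affine : ℕ → Set
  Affine m = Vector ℚ m × ℚ

  ⟦_⟧ : Affine m → Vector ℚ m → ℚ
  ⟦ c , d ⟧ a = sum (λ i → c i * a i) + d

  Constraint : ℕ → Set
  Constraint m = Affine m × Bool

  Sat : Vector ℚ m → Constraint m → Set
  Sat a (e , s) = 0ℚ ≲[ s ] ⟦ e ⟧ a

  scale : ℚ → Affine m → Affine m
  scale t (c , d) = (λ i → t * c i) , t * d

  ⟦scale⟧ : ∀ t (e : Affine m) a → ⟦ scale t e ⟧ a ≡ t * ⟦ e ⟧ a
  ⟦scale⟧ t (c , d) a = begin
    sum (λ i → t * c i * a i) + t * d    ≡⟨ cong (_+ t * d) (sum-cong-≗ λ i → ℚ.*-assoc t (c i) (a i)) ⟩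
    sum (λ i → t * (c i * a i)) + t * d  ≡⟨ cong (_+ t * d) (*-distribˡ-sum t (λ i → c i * a i)) ⟨
    t * sum (λ i → c i * a i) + t * d    ≡⟨ ℚ.*-distribˡ-+ t _ d ⟨
    t * (sum (λ i → c i * a i) + d)      ∎
    where open ≡-Reasoning

  add : Affine m → Affine m → Affine m
  add (c , d) (c′ , d′) = (λ i → c i + c′ i) , d + d′

  ⟦add⟧ : ∀ (e e′ : Affine m) a → ⟦ add e e′ ⟧ a ≡ ⟦ e ⟧ a + ⟦ e′ ⟧ a
  ⟦add⟧ (c , d) (c′ , d′) a = begin
    sum (λ i → (c i + c′ i) * a i) + (d + d′)
      ≡⟨ cong (_+ (d + d′)) (sum-cong-≗ λ i → ℚ.*-distribʳ-+ (a i) (c i) (c′ i)) ⟩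
    sum (λ i → c i * a i + c′ i * a i) + (d + d′)
      ≡⟨ cong (_+ (d + d′)) (∑-distrib-+ (λ i → c i * a i) (λ i → c′ i * a i)) ⟩
    (sum (λ i → c i * a i) + sum (λ i → c′ i * a i)) + (d + d′)
      ≡⟨ solve 4 (λ x y z w → (x :+ y) :+ (z :+ w) := (x :+ z) :+ (y :+ w)) refl (sum (λ i → c i * a i)) (sum (λ i → c′ i * a i)) d d′ ⟩
    ⟦ c , d ⟧ a + ⟦ c′ , d′ ⟧ a ∎
    where open ≡-Reasoning

  diff : Affine m → Affine m → Affine m
  diff u l = add u (scale (- 1ℚ) l)

  ⟦diff⟧ : ∀ (u l : Affine m) a → ⟦ diff u l ⟧ a ≡ ⟦ u ⟧ a - ⟦ l ⟧ a
  ⟦diff⟧ u l a = trans (⟦add⟧ u (scale (- 1ℚ) l) a)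
    (cong (⟦ u ⟧ a +_) (trans (⟦scale⟧ (- 1ℚ) l a)
      (solve 1 (λ x → con (- 1ℚ) :* x := :- x) refl (⟦ l ⟧ a))))

  shift : ∀ s {p q} → p ≲[ s ] q ⇔ 0ℚ ≲[ s ] q - p
  shift false {p} {q} = mk⇔
    (λ h → subst (_≤ q - p) (ℚ.+-inverseʳ p) (ℚ.+-monoˡ-≤ (- p) h))
    (λ h → subst₂ _≤_ (ℚ.+-identityˡ p) (back p q) (ℚ.+-monoˡ-≤ p h))
    where
    back : ∀ p q → q - p + p ≡ q
    back = solve 2 (λ p q → q :+ (:- p) :+ p := q) refl
  shift true {p} {q} = mk⇔
    (λ h → subst (_< q - p) (ℚ.+-inverseʳ p) (ℚ.+-monoˡ-< (- p) h))
    (λ h → subst₂ _<_ (ℚ.+-identityˡ p) (back p q) (ℚ.+-monoˡ-< p h))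
    where
    back : ∀ p q → q - p + p ≡ q
    back = solve 2 (λ p q → q :+ (:- p) :+ p := q) refl

  pos* : ∀ s c .{{_ : Positive c}} {z} → 0ℚ ≲[ s ] c * z ⇔ 0ℚ ≲[ s ] z
  pos* false c {z} = mk⇔
    (λ h → ℚ.*-cancelˡ-≤-pos c (subst (_≤ c * z) (sym (ℚ.*-zeroʳ c)) h))
    (λ h → subst (_≤ c * z) (ℚ.*-zeroʳ c) (ℚ.*-monoˡ-≤-nonNeg c {{ℚ.pos⇒nonNeg c}} h))
  pos* true c {z} = mk⇔
    (λ h → ℚ.*-cancelˡ-<-nonNeg c {{ℚ.pos⇒nonNeg c}} (subst (_< c * z) (sym (ℚ.*-zeroʳ c)) h))
    (λ h → subst (_< c * z) (ℚ.*-zeroʳ c) (ℚ.*-monoʳ-<-pos c h))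

  ≲-trans : ∀ s t {p q r} → p ≲[ s ] q → q ≲[ t ] r → p ≲[ s ∨ t ] r
  ≲-trans false false = ℚ.≤-trans
  ≲-trans false true  = ℚ.≤-<-trans
  ≲-trans true  false = ℚ.<-≤-trans
  ≲-trans true  true  = ℚ.<-trans

  <⇒≲ : ∀ s {p q} → p < q → p ≲[ s ] q
  <⇒≲ false = ℚ.<⇒≤
  <⇒≲ true  = id

  Bound : Set
  Bound = ℚ × Bool

  Above Below : Bound → ℚ → Set
  Above (p , s) x = p ≲[ s ] x
  Below (p , s) x = x ≲[ s ] p

  module _ (Q : Bound → ℚ → Set)
           (total : ∀ b c → (∀ x → Q b x → Q c x) ⊎ (∀ x → Q c x → Q b x)) where

    tightest : ∀ b bs → ∃ λ c → c ∈ˡ (b ∷ bs) × (∀ x → Q c x → All (λ d → Q d x) (b ∷ bs))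
    tightest b [] = b , here refl , λ x q → q ∷ []
    tightest b (b′ ∷ bs) with tightest b′ bs
    ... | c , c∈ , h with total b c
    ...   | inj₁ b⇒c = b , here refl , λ x q → q ∷ h x (b⇒c x q)
    ...   | inj₂ c⇒b = c , there c∈ , λ x q → c⇒b x q ∷ h x q

  weaken : ∀ s {p q} → p ≲[ s ] q → p ≤ q
  weaken false = id
  weaken true  = ℚ.<⇒≤

  <-≲ : ∀ s t {p q x} → p < q → q ≲[ t ] x → p ≲[ s ] x
  <-≲ s t p<q h = <⇒≲ s (ℚ.<-≤-trans p<q (weaken t h))

  flip : ∀ s {p q} → p ≲[ s ] q → - q ≲[ s ] - p
  flip false = ℚ.neg-antimono-≤
  flip true  = ℚ.neg-antimono-<

  unflip : ∀ s {p q} → - q ≲[ s ] - p → p ≲[ s ] q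
  unflip s {p} {q} h = subst₂ (λ y z → y ≲[ s ] z) (neg² p) (neg² q) (flip s h)
    where
    neg² : ∀ y → - (- y) ≡ y
    neg² = solve 1 (λ y → :- (:- y) := y) refl

  Above-total : ∀ b c → (∀ x → Above b x → Above c x) ⊎ (∀ x → Above c x → Above b x)
  Above-total (p , s) (q , t) with ℚ.<-cmp p q
  ... | tri< p<q _ _ = inj₂ λ x → <-≲ s t p<q
  ... | tri> _ _ q<p = inj₁ λ x → <-≲ t s q<p
  Above-total (p , true)  (.p , t) | tri≈ _ refl _ = inj₁ λ x → <⇒≲ t
  Above-total (p , false) (.p , t) | tri≈ _ refl _ = inj₂ λ x → weaken t

  Below-total : ∀ b c → (∀ x → Below b x → Below c x) ⊎ (∀ x → Below c x → Below b x)
  Below-total (p , s) (q , t) with Above-total (- p , s) (- q , t)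
  ... | inj₁ h = inj₁ λ x b → unflip t (h (- x) (flip s b))
  ... | inj₂ h = inj₂ λ x b → unflip s (h (- x) (flip t b))

  below : ∀ b → ∃ (Below b)
  below (p , s) = p - 1ℚ , <⇒≲ s (subst (p - 1ℚ <_) (ℚ.+-identityʳ p) (ℚ.+-monoʳ-< p (ℚ.negative⁻¹ (- 1ℚ))))

  above : ∀ b → ∃ (Above b)
  above (p , s) = p + 1ℚ , <⇒≲ s (subst (_< p + 1ℚ) (ℚ.+-identityʳ p) (ℚ.+-monoʳ-< p (ℚ.positive⁻¹ 1ℚ)))

  between : ∀ l u → proj₁ l ≲[ proj₂ l ∨ proj₂ u ] proj₁ u → ∃ λ x → Above l x × Below u x
  between (p , false) (q , t) h = p , ℚ.≤-refl , h
  between (p , true) (q , t) p<q with ℚ.<-dense p<q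
  ... | x , p<x , x<q = x , p<x , <⇒≲ t x<q

  Compatible : List Bound → List Bound → Set
  Compatible ls us = ∀ {l u} → l ∈ˡ ls → u ∈ˡ us → proj₁ l ≲[ proj₂ l ∨ proj₂ u ] proj₁ u

  interval : ∀ ls us → Compatible ls us → ∃ λ x → All (λ b → Above b x) ls × All (λ b → Below b x) us
  interval [] [] _ = 0ℚ , [] , []
  interval (l ∷ ls) [] _ with tightest Above Above-total l ls
  ... | b , _ , h = let x , b<x = above b in x , h x b<x , []
  interval [] (u ∷ us) _ with tightest Below Below-total u us
  ... | b , _ , h = let x , x<b = below b in x , [] , h x x<b
  interval (l ∷ ls) (u ∷ us) c
    with tightest Above Above-total l ls | tightest Below Below-total u us
  ... | b , b∈ , h | b′ , b′∈ , h′ =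
    let x , b<x , x<b′ = between b b′ (c b∈ b′∈) in x , h x b<x , h′ x x<b′

  -- Elimination of the first variable x: every constraint is a lower bound on x, an upper bound
  -- on x, or free of x.
  record Split (m : ℕ) : Set where
    constructor mkSplit
    field
      lowers uppers frees : List (Constraint m)

  open Split

  at : Vector ℚ m → Constraint m → Bound
  at a (e , s) = ⟦ e ⟧ a , s

  SatSplit : ℚ → Vector ℚ m → Split m → Set
  SatSplit x a sp = All (λ c → Above (at a c) x) (lowers sp)
                  × All (λ c → Below (at a c) x) (uppers sp)
                  × All (Sat a) (frees sp)

  root : (c₀ : ℚ) .{{_ : ℚ.NonZero c₀}} → Affine m → Affine m
  root c₀ e = scale (- (1/ c₀)) e

  ⟦root⟧ : ∀ c₀ .{{_ : ℚ.NonZero c₀}} (e : Affine m) a x →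
           c₀ * x + ⟦ e ⟧ a ≡ c₀ * (x - ⟦ root c₀ e ⟧ a)
  ⟦root⟧ c₀ e a x = begin
    c₀ * x + y                        ≡⟨ cong (c₀ * x +_) (ℚ.*-identityˡ y) ⟨
    c₀ * x + 1ℚ * y                   ≡⟨ cong (λ t → c₀ * x + t * y) (ℚ.*-inverseʳ c₀) ⟨
    c₀ * x + (c₀ * (1/ c₀)) * y       ≡⟨ solve 4 (λ c i x y → c :* x :+ (c :* i) :* y := c :* (x :+ (:- ((:- i) :* y)))) refl c₀ (1/ c₀) x y ⟩
    c₀ * (x - - (1/ c₀) * y)          ≡⟨ cong (λ t → c₀ * (x - t)) (⟦scale⟧ (- (1/ c₀)) e a) ⟨
    c₀ * (x - ⟦ root c₀ e ⟧ a)        ∎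
    where
    open ≡-Reasoning
    y = ⟦ e ⟧ a

  lower⇔ : ∀ s c₀ .{{_ : ℚ.NonZero c₀}} .{{_ : Positive c₀}} (e : Affine m) a x →
           0ℚ ≲[ s ] c₀ * x + ⟦ e ⟧ a ⇔ ⟦ root c₀ e ⟧ a ≲[ s ] x
  lower⇔ s c₀ e a x = mk⇔
    (λ h → from (shift s) (to (pos* s c₀) (subst (0ℚ ≲[ s ]_) (⟦root⟧ c₀ e a x) h)))
    (λ h → subst (0ℚ ≲[ s ]_) (sym (⟦root⟧ c₀ e a x)) (from (pos* s c₀) (to (shift s) h)))

  upper⇔ : ∀ s c₀ .{{_ : ℚ.NonZero c₀}} .{{_ : Positive (- c₀)}} (e : Affine m) a x →
           0ℚ ≲[ s ] c₀ * x + ⟦ e ⟧ a ⇔ x ≲[ s ] ⟦ root c₀ e ⟧ a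
  upper⇔ s c₀ e a x = mk⇔
    (λ h → from (shift s) (to (pos* s (- c₀)) (subst (0ℚ ≲[ s ]_) eq h)))
    (λ h → subst (0ℚ ≲[ s ]_) (sym eq) (from (pos* s (- c₀)) (to (shift s) h)))
    where
    eq : c₀ * x + ⟦ e ⟧ a ≡ - c₀ * (⟦ root c₀ e ⟧ a - x)
    eq = trans (⟦root⟧ c₀ e a x)
      (solve 3 (λ c x r → c :* (x :+ (:- r)) := (:- c) :* (r :+ (:- x))) refl c₀ x (⟦ root c₀ e ⟧ a))

  tailᵃ : Affine (suc m) → Affine m
  tailᵃ (c , d) = c ∘ suc , d

  headᵃ : Affine (suc m) → ℚ
  headᵃ (c , d) = c zero

  ⟦∷⟧ : ∀ (e : Affine (suc m)) a → ⟦ e ⟧ a ≡ headᵃ e * a zero + ⟦ tailᵃ e ⟧ (a ∘ suc)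
  ⟦∷⟧ (c , d) a = ℚ.+-assoc (c zero * a zero) _ d

  split : (cs : List (Constraint (suc m))) →
          ∃ λ (sp : Split m) → ∀ a → All (Sat a) cs ⇔ SatSplit (a zero) (a ∘ suc) sp
  split [] = mkSplit [] [] [] , λ a → mk⇔ (λ _ → [] , [] , []) (λ _ → [])
  split ((e , s) ∷ cs) with split cs | ℚ.<-cmp (headᵃ e) 0ℚ
  ... | mkSplit ls us fs , ih | tri< neg _ _ =
    mkSplit ls ((root c₀ (tailᵃ e) , s) ∷ us) fs , λ a → mk⇔
      (λ { (h ∷ hs) → let l , u , f = to (ih a) hs in
             l , to (upper⇔ s c₀ (tailᵃ e) (a ∘ suc) (a zero)) (subst (0ℚ ≲[ s ]_) (⟦∷⟧ e a) h) ∷ u , f })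
      (λ { (l , h ∷ u , f) →
             subst (0ℚ ≲[ s ]_) (sym (⟦∷⟧ e a)) (from (upper⇔ s c₀ (tailᵃ e) (a ∘ suc) (a zero)) h)
             ∷ from (ih a) (l , u , f) })
    where
    c₀ = headᵃ e
    instance
      c₀-neg : Negative c₀
      c₀-neg = ℚ.negative neg
      c₀≢0 : ℚ.NonZero c₀
      c₀≢0 = ℚ.neg⇒nonZero c₀
      -c₀-pos : Positive (- c₀)
      -c₀-pos = ℚ.positive (ℚ.neg-antimono-< neg)
  ... | mkSplit ls us fs , ih | tri> _ _ pos =
    mkSplit ((root c₀ (tailᵃ e) , s) ∷ ls) us fs , λ a → mk⇔
      (λ { (h ∷ hs) → let l , u , f = to (ih a) hs in
             to (lower⇔ s c₀ (tailᵃ e) (a ∘ suc) (a zero)) (subst (0ℚ ≲[ s ]_) (⟦∷⟧ e a) h) ∷ l , u , f })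
      (λ { (h ∷ l , u , f) →
             subst (0ℚ ≲[ s ]_) (sym (⟦∷⟧ e a)) (from (lower⇔ s c₀ (tailᵃ e) (a ∘ suc) (a zero)) h)
             ∷ from (ih a) (l , u , f) })
    where
    c₀ = headᵃ e
    instance
      c₀-pos : Positive c₀
      c₀-pos = ℚ.positive pos
      c₀≢0 : ℚ.NonZero c₀
      c₀≢0 = ℚ.pos⇒nonZero c₀
  ... | mkSplit ls us fs , ih | tri≈ _ c₀≡0 _ =
    mkSplit ls us ((tailᵃ e , s) ∷ fs) , λ a → mk⇔
      (λ { (h ∷ hs) → let l , u , f = to (ih a) hs in l , u , subst (0ℚ ≲[ s ]_) (eq a) h ∷ f })
      (λ { (l , u , h ∷ f) → subst (0ℚ ≲[ s ]_) (sym (eq a)) h ∷ from (ih a) (l , u , f) })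
    where
    eq : ∀ a → ⟦ e ⟧ a ≡ ⟦ tailᵃ e ⟧ (a ∘ suc)
    eq a = trans (⟦∷⟧ e a) (trans (cong (λ c → c * a zero + ⟦ tailᵃ e ⟧ (a ∘ suc)) c₀≡0)
      (trans (cong (_+ ⟦ tailᵃ e ⟧ (a ∘ suc)) (ℚ.*-zeroˡ (a zero))) (ℚ.+-identityˡ _)))

  combine : Constraint m → Constraint m → Constraint m
  combine (l , s) (u , t) = diff u l , s ∨ t

  Sat-combine : ∀ (l u : Constraint m) a →
    Sat a (combine l u) ⇔ ⟦ proj₁ l ⟧ a ≲[ proj₂ l ∨ proj₂ u ] ⟦ proj₁ u ⟧ a
  Sat-combine (l , s) (u , t) a = mk⇔
    (λ h → from (shift (s ∨ t)) (subst (0ℚ ≲[ s ∨ t ]_) (⟦diff⟧ u l a) h))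
    (λ h → subst (0ℚ ≲[ s ∨ t ]_) (sym (⟦diff⟧ u l a)) (to (shift (s ∨ t)) h))

  satisfiable? : (cs : List (Constraint m)) → Dec (∃ λ a → All (Sat a) cs)
  satisfiable? {zero} cs = map′ (λ h → (λ ()) , h) (λ { (a , h) → All.map id h }) (All.all? sat₀? cs)
    where
    sat₀? : ∀ c → Dec (Sat {zero} (λ ()) c)
    sat₀? (e , false) = 0ℚ ℚ.≤? ⟦ e ⟧ λ ()
    sat₀? (e , true)  = 0ℚ ℚ.<? ⟦ e ⟧ λ ()
  satisfiable? {suc m} cs with split cs
  ... | mkSplit ls us fs , equiv = map′ ⇒ ⇐ (satisfiable? (cartesianProductWith combine ls us ++ fs))
    where
    ⇒ : _ → ∃ λ a → All (Sat a) cs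
    ⇒ (a , h) with All.++⁻ (cartesianProductWith combine ls us) h
    ... | pairs , free with interval (map (at a) ls) (map (at a) us) compat
      where
      compat : Compatible (map (at a) ls) (map (at a) us)
      compat l∈ u∈ with List.∈-map⁻ (at a) l∈ | List.∈-map⁻ (at a) u∈
      ... | l , l∈ls , refl | u , u∈us , refl =
        to (Sat-combine l u a) (All.lookup pairs (List.∈-cartesianProductWith⁺ combine l∈ls u∈us))
    ... | x , hl , hu = (x ∷ᶠ a) , from (equiv (x ∷ᶠ a)) (All.map⁻ hl , All.map⁻ hu , free)

    ⇐ : (∃ λ a → All (Sat a) cs) → ∃ λ a → All (Sat a) (cartesianProductWith combine ls us ++ fs)
    ⇐ (a , h) = let hl , hu , f = to (equiv a) h in
      a ∘ suc , All.++⁺ (All.cartesianProductWith⁺ (setoid _) (setoid _) combine ls us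
        (λ {l} {u} l∈ u∈ → from (Sat-combine l u (a ∘ suc))
          (≲-trans (proj₂ l) (proj₂ u) (All.lookup hl l∈) (All.lookup hu u∈)))) f

  Definable : Pred (Vector ℚ m) 0ℓ → Set
  Definable {m} P = ∃ λ (cs : List (Constraint m)) → ∀ a → All (Sat a) cs ⇔ P a

  definable⇒dec : {P : Pred (Vector ℚ m) 0ℓ} → Definable P → Dec (∃ P)
  definable⇒dec (cs , equiv) =
    map′ (λ (a , h) → a , to (equiv a) h) (λ (a , h) → a , from (equiv a) h) (satisfiable? cs)

  _×-def_ : {P Q : Pred (Vector ℚ m) 0ℓ} → Definable P → Definable Q → Definable (λ a → P a × Q a)
  (cs , f) ×-def (ds , g) = cs ++ ds , λ a → mk⇔
    (λ h → let h₁ , h₂ = All.++⁻ cs h in to (f a) h₁ , to (g a) h₂)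
    (λ (p , q) → All.++⁺ (from (f a) p) (from (g a) q))

  ∀-def : {P : Fin k → Pred (Vector ℚ m) 0ℓ} → (∀ i → Definable (P i)) → Definable (λ a → ∀ i → P i a)
  ∀-def {zero}  d = [] , λ a → mk⇔ (λ _ ()) (λ _ → [])
  ∀-def {suc k} d with d zero ×-def ∀-def (d ∘ suc)
  ... | cs , f = cs , λ a → mk⇔
    (λ h → λ { zero → proj₁ (to (f a) h) ; (suc i) → proj₂ (to (f a) h) i })
    (λ p → from (f a) (p zero , p ∘ suc))

  →-def : {Q : Set} {P : Pred (Vector ℚ m) 0ℓ} → Dec Q → (Q → Definable P) → Definable (λ a → Q → P a)
  →-def (yes q) d with d q
  ... | cs , f = cs , λ a → mk⇔ (λ h _ → to (f a) h) (λ p → from (f a) (p q))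
  →-def (no ¬q) d = [] , λ a → mk⇔ (λ _ q → contradiction q ¬q) (λ _ → [])

  ≡-def : (c : Vector ℚ m) (d : ℚ) → Definable (λ a → sum (λ i → a i * c i) ≡ d)
  ≡-def c d = (e , false) ∷ (scale (- 1ℚ) e , false) ∷ [] , λ a → mk⇔
    (λ { (h ∷ h′ ∷ []) → trans (sum-cong-≗ (λ i → ℚ.*-comm (a i) (c i)))
      (zero-diff _ d (ℚ.≤-antisym
        (unflip false (subst (0ℚ ≤_) (trans (⟦scale⟧ (- 1ℚ) e a) (-1* (⟦ e ⟧ a))) h′)) h)) })
    (λ eq → let e≡0 = trans (cong (_- d) (trans (sum-cong-≗ (λ i → ℚ.*-comm (c i) (a i))) eq)) (ℚ.+-inverseʳ d) in
      ℚ.≤-reflexive (sym e≡0) ∷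
      ℚ.≤-reflexive (sym (trans (⟦scale⟧ (- 1ℚ) e a) (cong (- 1ℚ *_) e≡0))) ∷ [])
    where
    e = c , - d
    -1* : ∀ x → - 1ℚ * x ≡ - x
    -1* = solve 1 (λ x → con (- 1ℚ) :* x := :- x) refl
    zero-diff : ∀ x y → x - y ≡ 0ℚ → x ≡ y
    zero-diff x y eq = trans (solve 2 (λ x y → x := x :+ (:- y) :+ y) refl x y)
      (trans (cong (_+ y) eq) (ℚ.+-identityˡ y))

  ind : Fin m → Vector ℚ m
  ind zero    = 1ℚ ∷ᶠ λ _ → 0ℚ
  ind (suc i) = 0ℚ ∷ᶠ ind i

  sum-0 : (a : Vector ℚ m) → sum (λ i → 0ℚ * a i) ≡ 0ℚ
  sum-0 {m} a = trans (sym (*-distribˡ-sum 0ℚ a)) (ℚ.*-zeroˡ (sum a))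

  sum-ind : (i : Fin m) (a : Vector ℚ m) → sum (λ j → ind i j * a j) ≡ a i
  sum-ind zero a = trans (cong (1ℚ * a zero +_) (sum-0 (a ∘ suc)))
    (trans (ℚ.+-identityʳ _) (ℚ.*-identityˡ _))
  sum-ind (suc i) a = trans (cong (0ℚ * a zero +_) (sum-ind i (a ∘ suc)))
    (trans (cong (_+ a (suc i)) (ℚ.*-zeroˡ (a zero))) (ℚ.+-identityˡ _))

  ⟦ind⟧ : (i : Fin m) (a : Vector ℚ m) → ⟦ ind i , 0ℚ ⟧ a ≡ a i
  ⟦ind⟧ i a = trans (ℚ.+-identityʳ _) (sum-ind i a)

  ≥0-def : (i : Fin m) → Definable (λ a → 0ℚ ≤ a i)
  ≥0-def i = ((ind i , 0ℚ) , false) ∷ [] , λ a → mk⇔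
    (λ { (h ∷ []) → subst (0ℚ ≤_) (⟦ind⟧ i a) h })
    (λ h → subst (0ℚ ≤_) (sym (⟦ind⟧ i a)) h ∷ [])

  >0-def : (i : Fin m) → Definable (λ a → 0ℚ < a i)
  >0-def i = ((ind i , 0ℚ) , true) ∷ [] , λ a → mk⇔
    (λ { (h ∷ []) → subst (0ℚ <_) (⟦ind⟧ i a) h })
    (λ h → subst (0ℚ <_) (sym (⟦ind⟧ i a)) h ∷ [])

  <1-def : (i : Fin m) → Definable (λ a → a i < 1ℚ)
  <1-def i = (diff ((λ _ → 0ℚ) , 1ℚ) (ind i , 0ℚ) , true) ∷ [] , λ a → mk⇔
    (λ { (h ∷ []) → from (shift true) (subst (0ℚ <_) (eq a) h) })
    (λ h → subst (0ℚ <_) (sym (eq a)) (to (shift true) h) ∷ [])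
    where
    eq : ∀ a → ⟦ diff ((λ _ → 0ℚ) , 1ℚ) (ind i , 0ℚ) ⟧ a ≡ 1ℚ - a i
    eq a = trans (⟦diff⟧ ((λ _ → 0ℚ) , 1ℚ) (ind i , 0ℚ) a)
      (subst₂ (λ x y → (x + 1ℚ) - y ≡ 1ℚ - a i) (sym (sum-0 a)) (sym (⟦ind⟧ i a)) refl)

  =0-def : (i : Fin m) → Definable (λ a → a i ≡ 0ℚ)
  =0-def i with ≡-def (ind i) 0ℚ
  ... | cs , f = cs , λ a →
    let eq = trans (sum-cong-≗ λ j → ℚ.*-comm (a j) (ind i j)) (sum-ind i a) in mk⇔
    (λ h → trans (sym eq) (to (f a) h))
    (λ h → from (f a) (trans eq h))

  positive⇔ : ∀ {x} → 0ℚ ≤ x → 0ℚ < x ⇔ x ≢ 0ℚ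
  positive⇔ {x} 0≤x = mk⇔ (λ 0<x x≡0 → ℚ.<-irrefl (sym x≡0) 0<x) ⇐
    where
    ⇐ : x ≢ 0ℚ → 0ℚ < x
    ⇐ x≢0 with ℚ.<-cmp 0ℚ x
    ... | tri< 0<x _ _ = 0<x
    ... | tri≈ _ 0≡x _ = contradiction (sym 0≡x) x≢0
    ... | tri> _ _ x<0 = contradiction (ℚ.≤-<-trans 0≤x x<0) (ℚ.<-irrefl refl)

------------------------------------------------------------------------
-- The lattice N = ℤⁿ and the space N_ℚ = ℚⁿ.  Only rational cones occur,
-- and these are determined by their rational points, so N_ℚ replaces N_ℝ.

Lattice : ℕ → Set
Lattice n = Vec ℤ n

Point : ℕ → Set
Point n = Vector ℚ n

infixl 6 _+ᴺ_ _-ᴺ_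

_+ᴺ_ _-ᴺ_ : Lattice n → Lattice n → Lattice n
_+ᴺ_ = zipWith ℤ._+_
_-ᴺ_ = zipWith ℤ._-_

0ᴺ : Lattice n
0ᴺ = replicate _ 0ℤ

_≟ᴺ_ : DecidableEquality (Lattice n)
_≟ᴺ_ = Vec.≡-dec ℤ._≟_

point : Lattice n → Point n
point w i = lookup w i ℚ./ 1

combination : (Fin m → Lattice n) → Vector ℚ m → Point n
combination g a k = sum λ i → a i * point (g i) k

-- coneOf g τ is the cone spanned by the gᵢ with i ∈ τ.
coneOf : (Fin m → Lattice n) → Subset m → Pred (Point n) 0ℓ
coneOf g τ p = ∃ λ a →
  (∀ i → i ∉ τ → a i ≡ 0ℚ) × (∀ i → 0ℚ ≤ a i) × combination g a ≗ p

LinearlyIndependent : (Fin m → Lattice n) → Subset m → Set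
LinearlyIndependent g τ = ∀ a → (∀ i → i ∉ τ → a i ≡ 0ℚ) →
  combination g a ≗ (λ _ → 0ℚ) → ∀ i → a i ≡ 0ℚ

-- The case d = 0 excludes w = 0.
Primitive : Lattice n → Set
Primitive w = ∀ (d : ℕ) u → w ≡ mapᵛ (ℤ.+ d ℤ.*_) u → d ≡ 1

record RationalCone (n : ℕ) : Set where
  field
    {size}    : ℕ
    generator : Fin size → Lattice n

  Contains : Pred (Point n) 0ℓ
  Contains = coneOf generator ⊤

open RationalCone public using (Contains)

StronglyConvex : RationalCone n → Set
StronglyConvex σ = ∀ p → Contains σ p → Contains σ (λ k → - p k) → p ≗ λ _ → 0ℚ

-- A rational simplicial fan.  Each cone is recorded by the set of (indices of) its rays, as a
-- simplicial cone and its generators determine each other.  The faces of a simplicial cone are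
-- the cones spanned by subsets of its generators, so "is a face of" is ⊆; the intersection of
-- two cones being a common face means that it is spanned by their common rays.
record SimplicialFan (n : ℕ) : Set where
  field
    {rays}      : ℕ
    v           : Fin rays → Lattice n
    cones       : List (Subset rays)
    unique      : Unique cones
    v-primitive : ∀ i → Primitive (v i)
    ray∈        : ∀ i → ⁅ i ⁆ ∈ˡ cones
    simplicial  : ∀ {τ} → τ ∈ˡ cones → LinearlyIndependent v τ
    face-closed : ∀ {τ ρ} → τ ∈ˡ cones → ρ ⊆ τ → ρ ∈ˡ cones
    ∩-face      : ∀ {τ τ′} → τ ∈ˡ cones → τ′ ∈ˡ cones →
                  ∀ p → coneOf v τ p → coneOf v τ′ p → coneOf v (τ ∩ τ′) p

infix 4 _Subdivides_

_Subdivides_ : SimplicialFan n → RationalCone n → Set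
Δ Subdivides σ = ∀ p → Contains σ p ⇔ ∃ λ τ → τ ∈ˡ cones × coneOf v τ p
  where open SimplicialFan Δ

------------------------------------------------------------------------
-- Laurent polynomials as finite sums of terms c x^u, acting on formal
-- series (functions N → ℤ) by multiplication.

Laurent : ℕ → Set
Laurent n = List (ℤ × Lattice n)

Series : ℕ → Set
Series n = Lattice n → ℤ

x^_ : Lattice n → Laurent n
x^ u = [ 1ℤ , u ]

1-x^_ : Lattice n → Laurent n
1-x^ u = (1ℤ , 0ᴺ) ∷ (-1ℤ , u) ∷ []

infixl 7 _·_
infixr 7 _•_
infixl 6 _⊕_

_·_ : Laurent n → Laurent n → Laurent n
_·_ = cartesianProductWith λ (c , u) (d , w) → c ℤ.* d , u +ᴺ w

∏ : List (Laurent n) → Laurent n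
∏ = foldr _·_ (x^ 0ᴺ)

_⊕_ : Series n → Series n → Series n
(f ⊕ g) w = f w ℤ.+ g w

∑ : List (Series n) → Series n
∑ = foldr _⊕_ λ _ → 0ℤ

_•_ : Laurent n → Series n → Series n
(p • f) w = foldr (λ (c , u) r → c ℤ.* f (w -ᴺ u) ℤ.+ r) 0ℤ p

genFun : {P : Pred (Lattice n) 0ℓ} → Decidable P → Series n
genFun P? w = if does (P? w) then 1ℤ else 0ℤ

-- The Laurent polynomial p regarded as a series.
coeff : Laurent n → Series n
coeff p = p • genFun (_≟ᴺ 0ᴺ)

coneOf? : (g : Fin m → Lattice n) (τ : Subset m) → Decidable (coneOf g τ)
coneOf? g τ p = definable⇒dec
  (∀-def (λ i → →-def (¬? (i ∈? τ)) λ _ → =0-def i) ×-def (∀-def ≥0-def ×-def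
   ∀-def λ k → ≡-def (λ i → point (g i) k) (p k)))

G : RationalCone n → Series n
G σ = genFun λ w → coneOf? generator ⊤ (point w)
  where open RationalCone σ

module _ (Δ : SimplicialFan n) where
  open SimplicialFan Δ

  private
    _≟ˢ_ : DecidableEquality (Subset rays)
    _≟ˢ_ = Vec.≡-dec Bool._≟_

    open DecMembership _≟ˢ_ using () renaming (_∈?_ to _∈ˡ?_)

  Maximal : Pred (Subset rays) 0ℓ
  Maximal μ = μ ∈ˡ cones × All (λ ν → μ ⊆ ν → μ ≡ ν) cones

  maximal? : Decidable Maximal
  maximal? μ = (μ ∈ˡ? cones) ×-dec All.all? (λ ν → (μ ⊆? ν) →-dec (μ ≟ˢ ν)) cones

  -- InLink τ γ means γ ∈ lk τ: the condition γ ∩ τ = 0 says that γ and τ have no common ray,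
  -- and the cone γ + τ is spanned by γ ∪ τ.
  InLink : (τ : Subset rays) → Pred (Subset rays) 0ℓ
  InLink τ γ = γ ∈ˡ cones × γ ∩ τ ≡ ⊥ × γ ∪ τ ∈ˡ cones

  inLink? : ∀ τ → Decidable (InLink τ)
  inLink? τ γ = (γ ∈ˡ? cones) ×-dec ((γ ∩ τ) ≟ˢ ⊥) ×-dec ((γ ∪ τ) ∈ˡ? cones)

  RayOfLink : (τ : Subset rays) → Pred (Fin rays) 0ℓ
  RayOfLink τ j = Any (λ γ → InLink τ γ × j ∈ γ) cones

  rayOfLink? : ∀ τ → Decidable (RayOfLink τ)
  rayOfLink? τ j = any? (λ γ → inLink? τ γ ×-dec j ∈? γ) cones

  RayOfStar : (τ : Subset rays) → Pred (Fin rays) 0ℓ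
  RayOfStar τ j = Any (λ μ → Maximal μ × τ ⊆ μ × j ∈ μ) cones

  rayOfStar? : ∀ τ → Decidable (RayOfStar τ)
  rayOfStar? τ j = any? (λ μ → maximal? μ ×-dec τ ⊆? μ ×-dec j ∈? μ) cones

  ∏over : {P : Pred (Fin rays) 0ℓ} → Decidable P → (Lattice n → Laurent n) → Laurent n
  ∏over P? f = ∏ (map (f ∘ v) (filter P? (allFin rays)))

  -- H τ is H_{lk τ}.
  H : Subset rays → Laurent n
  H τ = concat (map term (filter (inLink? τ) cones))
    where
    term : Subset rays → Laurent n
    term γ = ∏over (_∈? γ) x^_ · ∏over (λ j → rayOfLink? τ j ×-dec ¬? (j ∈? γ)) 1-x^_

  Box : (τ ρ : Subset rays) → Pred (Point n) 0ℓ
  Box τ ρ p = ∃ λ a →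
    (∀ i → i ∉ τ → a i ≡ 0ℚ) ×
    (∀ i → 0ℚ ≤ a i) ×
    (∀ i → a i < 1ℚ) ×
    (∀ i → i ∈ τ → i ∉ ρ → a i ≢ 0ℚ) ×
    combination v a ≗ p

  box? : ∀ τ ρ → Decidable (Box τ ρ)
  box? τ ρ p = map′
    (λ (a , off , ≥0 , <1 , >0 , eq) → a , off , ≥0 , <1 , (λ i i∈τ i∉ρ → to (positive⇔ (≥0 i)) (>0 i i∈τ i∉ρ)) , eq)
    (λ (a , off , ≥0 , <1 , ≢0 , eq) → a , off , ≥0 , <1 , (λ i i∈τ i∉ρ → from (positive⇔ (≥0 i)) (≢0 i i∈τ i∉ρ)) , eq)
    (definable⇒dec
      (∀-def (λ i → →-def (¬? (i ∈? τ)) λ _ → =0-def i) ×-def (∀-def ≥0-def ×-def (∀-def <1-def ×-def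
       (∀-def (λ i → →-def (i ∈? τ) λ _ → →-def (¬? (i ∈? ρ)) λ _ → >0-def i) ×-def
       ∀-def λ k → ≡-def (λ i → point (v i) k) (p k))))))

  -- The sum of x^w over the nonzero lattice points w of Box(τ, ρ).  The origin lies in
  -- Box(τ, ρ) only for τ = ρ; there its contribution is the separate summand H_{lk ρ} of the
  -- identity, which would be counted twice if the origin were kept.
  B : (τ ρ : Subset rays) → Series n
  B τ ρ = genFun λ w → box? τ ρ (point w) ×-dec ¬? (w ≟ᴺ 0ᴺ)

{-# OPTIONS --safe #-}

-- If ρ lies in every maximal cone, every lattice point of σ is uniquely u + Σ mᵢ vᵢ with u in
-- Box(τ, ρ) for a cone τ ⊇ ρ and the mᵢ natural numbers such that τ and the vᵢ with mᵢ > 0 span a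
-- cone of Δ: take fractional and integral parts of the coordinates. Grouping by τ and by the set
-- γ ∈ lk τ of the i ∉ τ with mᵢ > 0 splits G_σ into series, one for each pair (τ, γ), that factors
-- over the coordinates of the cone γ ∪ τ. Multiplication by 1 - x^{vᵢ} turns the i-th factor, which
-- is periodic on the non-negative numbers, into its restriction to [0,1); the factors 1 - x^{vⱼ}
-- with j ∉ γ ∪ τ are those of H_{lk τ} and those with vⱼ ∉ Star τ. The origin, which lies in
-- Box(τ, ρ) only for τ = ρ, contributes H_{lk ρ}.

module Submission where

open import Defs
import Data.Integer.Properties as ℤ
import Data.Rational.Properties as ℚ
open import Algebra.Bundles using (module CommutativeRing)
open import Algebra.Properties.CommutativeMonoid.Sum ℤ.*-1-commutativeMonoid using () renaming (sum to prod; sum-cong-≗ to prod-cong)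
open import Algebra.Properties.Semiring.Sum (CommutativeRing.semiring ℚ.+-*-commutativeRing) using (sum; sum-cong-≗; *-distribˡ-sum)
import Data.Bool.Properties as Bool
open import Data.Fin.Base using (Fin; zero; suc)
open import Data.Fin.Properties using (_≟_; all?; ¬∀⟶∃¬)
open import Data.Fin.Subset using (Subset; _∉_; _⊆_; _∩_; _∪_; ⊤; ⊥; ⁅_⁆; _⊃_) renaming (_∈_ to _∈ₛ_)
open import Data.Fin.Subset.Induction using (⊃-wellFounded)
open import Data.Fin.Subset.Properties using (_∈?_; _⊆?_; _⊂?_; ⊆-antisym; ⊆-trans; ⊆-refl; ∉⊥; Empty-unique; x∈⁅y⁆⇒x≡y; x∈⁅x⁆; x∈p∩q⁺; x∈p∩q⁻; x∈p∪q⁻; p⊆p∪q; q⊆p∪q)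
open import Data.Integer.Base as ℤ using (ℤ; 0ℤ; 1ℤ; -1ℤ; +_; -[1+_]; +[1+_])
import Data.Integer.DivMod as ℤ
open import Data.Integer.Tactic.RingSolver using (solve-∀)
open import Data.List.Base using (List; []; _∷_; _++_; map; filter; concat; allFin)
open import Data.List.Membership.Propositional using (_∈_; lose; find)
open import Data.List.Membership.Propositional.Properties using (∈-allFin; ∈-filter⁺; ∈-filter⁻)
open import Data.List.Properties using (filter-accept; filter-reject; filter-none)
open import Data.List.Relation.Unary.All as All using ([]; _∷_)
open import Data.List.Relation.Unary.AllPairs using ([]; _∷_)
open import Data.List.Relation.Unary.Any using (here; there; any?)
open import Data.List.Relation.Unary.Unique.Propositional using (Unique)
open import Data.List.Relation.Unary.Unique.Propositional.Properties using (allFin⁺; filter⁺)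
open import Data.Nat.Base as ℕ using (ℕ)
open import Data.Product.Base using (∃; _×_; _,_; proj₁; proj₂)
open import Data.Rational.Base as ℚ using (ℚ; 0ℚ; 1ℚ; _+_; _-_; -_; _*_; _≤_; _<_; floor; toℚᵘ; mkℚ)
open import Data.Rational.Solver using (module +-*-Solver)
import Data.Rational.Unnormalised.Base as ℚᵘ
import Data.Rational.Unnormalised.Properties as ℚᵘ
open import Data.Sum.Base using (_⊎_; inj₁; inj₂; [_,_]′)
open import Data.Vec.Base using (lookup; tabulate; []; _∷_)
import Data.Vec.Properties as Vec
open import Data.Vec.Functional using (Vector; updateAt)
open import Data.Vec.Functional.Properties using (updateAt-updates; updateAt-minimal)
open import Function.Base using (_∘_; const)
open import Function.Bundles using (Equivalence)
open import Induction.WellFounded using (Acc; acc)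
open import Level using (0ℓ)
open import Relation.Binary.Definitions using (DecidableEquality)
open import Relation.Binary.PropositionalEquality using (_≡_; _≢_; _≗_; refl; sym; trans; cong; cong₂; subst; subst₂; module ≡-Reasoning)
open import Relation.Nullary using (Dec; yes; no; ¬_; does; contradiction; ¬?; _×-dec_; _⊎-dec_; _→-dec_; decidable-stable)
open import Relation.Nullary.Decidable using (dec-true)
open import Relation.Unary using (Pred; Decidable)

open +-*-Solver using (solve; _:=_; _:+_; _:*_; :-_; con)

private
  variable
    m n : ℕ
    A : Set

-- Laurent polynomials acting on series

-ᴺ-+ᴺ : (w u v : Lattice n) → w -ᴺ (u +ᴺ v) ≡ w -ᴺ u -ᴺ v
-ᴺ-+ᴺ []      []      []      = refl
-ᴺ-+ᴺ (x ∷ w) (y ∷ u) (z ∷ v) = cong₂ _∷_ (lemma x y z) (-ᴺ-+ᴺ w u v)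
  where
  lemma : ∀ x y z → x ℤ.- (y ℤ.+ z) ≡ x ℤ.- y ℤ.- z
  lemma = solve-∀

-ᴺ-comm : (w u v : Lattice n) → w -ᴺ u -ᴺ v ≡ w -ᴺ v -ᴺ u
-ᴺ-comm []      []      []      = refl
-ᴺ-comm (x ∷ w) (y ∷ u) (z ∷ v) = cong₂ _∷_ (lemma x y z) (-ᴺ-comm w u v)
  where
  lemma : ∀ x y z → x ℤ.- y ℤ.- z ≡ x ℤ.- z ℤ.- y
  lemma = solve-∀

-ᴺ-identityʳ : (w : Lattice n) → w -ᴺ 0ᴺ ≡ w
-ᴺ-identityʳ []      = refl
-ᴺ-identityʳ (x ∷ w) = cong₂ _∷_ (ℤ.+-identityʳ x) (-ᴺ-identityʳ w)

•-cong : ∀ (p : Laurent n) {f g} → f ≗ g → p • f ≗ p • g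
•-cong []            f≗g w = refl
•-cong ((c , u) ∷ p) f≗g w = cong₂ (λ x y → c ℤ.* x ℤ.+ y) (f≗g (w -ᴺ u)) (•-cong p f≗g w)

•-⊕ : ∀ (p : Laurent n) f g → p • (f ⊕ g) ≗ (p • f) ⊕ (p • g)
•-⊕ []            f g w = refl
•-⊕ ((c , u) ∷ p) f g w = trans
  (cong (λ r → c ℤ.* (f (w -ᴺ u) ℤ.+ g (w -ᴺ u)) ℤ.+ r) (•-⊕ p f g w))
  (lemma c (f (w -ᴺ u)) (g (w -ᴺ u)) ((p • f) w) ((p • g) w))
  where
  lemma : ∀ c x y r s → c ℤ.* (x ℤ.+ y) ℤ.+ (r ℤ.+ s) ≡ (c ℤ.* x ℤ.+ r) ℤ.+ (c ℤ.* y ℤ.+ s)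
  lemma = solve-∀

•-zero : ∀ (p : Laurent n) → p • (λ _ → 0ℤ) ≗ λ _ → 0ℤ
•-zero []            w = refl
•-zero ((c , u) ∷ p) w = cong₂ ℤ._+_ (ℤ.*-zeroʳ c) (•-zero p w)

++-• : ∀ (p q : Laurent n) f → (p ++ q) • f ≗ (p • f) ⊕ (q • f)
++-• []            q f w = sym (ℤ.+-identityˡ _)
++-• ((c , u) ∷ p) q f w = trans (cong (λ r → c ℤ.* f (w -ᴺ u) ℤ.+ r) (++-• p q f w))
  (sym (ℤ.+-assoc (c ℤ.* f (w -ᴺ u)) _ _))

private
  map-• : ∀ c u (q : Laurent n) f w →
          (map (λ (d , v) → c ℤ.* d , u +ᴺ v) q • f) w ≡ c ℤ.* (q • f) (w -ᴺ u)
  map-• c u []            f w = sym (ℤ.*-zeroʳ c)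
  map-• c u ((d , v) ∷ q) f w = trans
    (cong₂ (λ x y → c ℤ.* d ℤ.* f x ℤ.+ y) (-ᴺ-+ᴺ w u v) (map-• c u q f w))
    (lemma c d (f (w -ᴺ u -ᴺ v)) _)
    where
    lemma : ∀ c d x r → c ℤ.* d ℤ.* x ℤ.+ c ℤ.* r ≡ c ℤ.* (d ℤ.* x ℤ.+ r)
    lemma = solve-∀

•-· : ∀ (p q : Laurent n) f → (p · q) • f ≗ p • (q • f)
•-· []            q f w = refl
•-· ((c , u) ∷ p) q f w = trans (++-• (map _ q) (p · q) f w)
  (cong₂ ℤ._+_ (map-• c u q f w) (•-· p q f w))

-- The lists `p · q` and `q · p` differ in general, so commutativity is expressed through the
-- action: both sides translate the argument by the same vectors, in either order.
•-comm : ∀ (p q : Laurent n) f → p • (q • f) ≗ q • (p • f)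
•-comm []            q f w = sym (•-zero q w)
•-comm ((c , u) ∷ p) q f w = trans
  (cong₂ ℤ._+_ (term q w) (•-comm p q f w))
  (sym (•-⊕ q (λ w → c ℤ.* f (w -ᴺ u)) (p • f) w))
  where
  term : ∀ q w → c ℤ.* (q • f) (w -ᴺ u) ≡ (q • λ w → c ℤ.* f (w -ᴺ u)) w
  term []            w = ℤ.*-zeroʳ c
  term ((d , v) ∷ q) w = trans (lemma c d (f (w -ᴺ u -ᴺ v)) _)
    (cong₂ (λ x y → d ℤ.* (c ℤ.* f x) ℤ.+ y) (-ᴺ-comm w u v) (term q w))
    where
    lemma : ∀ c d x r → c ℤ.* (d ℤ.* x ℤ.+ r) ≡ d ℤ.* (c ℤ.* x) ℤ.+ c ℤ.* r
    lemma = solve-∀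

x^-• : ∀ u (f : Series n) w → ((x^ u) • f) w ≡ f (w -ᴺ u)
x^-• u f w = trans (ℤ.+-identityʳ _) (ℤ.*-identityˡ _)

x^0-• : (f : Series n) → (x^ 0ᴺ) • f ≗ f
x^0-• f w = trans (x^-• 0ᴺ f w) (cong f (-ᴺ-identityʳ w))

1-x^-• : ∀ u (f : Series n) w → ((1-x^ u) • f) w ≡ f w ℤ.- f (w -ᴺ u)
1-x^-• u f w = trans (lemma (f (w -ᴺ 0ᴺ)) (f (w -ᴺ u)))
  (cong (λ x → f x ℤ.- f (w -ᴺ u)) (-ᴺ-identityʳ w))
  where
  lemma : ∀ x y → 1ℤ ℤ.* x ℤ.+ (-1ℤ ℤ.* y ℤ.+ 0ℤ) ≡ x ℤ.- y
  lemma = solve-∀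

•-∑ : ∀ (p : Laurent n) (F : A → Series n) xs →
      p • ∑ (map F xs) ≗ ∑ (map (λ x → p • F x) xs)
•-∑ p F []       w = •-zero p w
•-∑ p F (x ∷ xs) w = trans (•-⊕ p (F x) (∑ (map F xs)) w) (cong (λ r → (p • F x) w ℤ.+ r) (•-∑ p F xs w))

concat-• : ∀ (P : A → Laurent n) f xs →
           concat (map P xs) • f ≗ ∑ (map (λ x → P x • f) xs)
concat-• P f []       w = refl
concat-• P f (x ∷ xs) w = trans (++-• (P x) (concat (map P xs)) f w)
  (cong (λ r → (P x • f) w ℤ.+ r) (concat-• P f xs w))

∑-cong : ∀ (F H : A → Series n) xs → (∀ {x} → x ∈ xs → F x ≗ H x) →
         ∑ (map F xs) ≗ ∑ (map H xs)
∑-cong F H []       F≗H w = refl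
∑-cong F H (x ∷ xs) F≗H w = cong₂ ℤ._+_ (F≗H (here refl) w) (∑-cong F H xs (F≗H ∘ there) w)

∑-⊕ : ∀ (F H : A → Series n) xs →
      ∑ (map (λ x → F x ⊕ H x) xs) ≗ ∑ (map F xs) ⊕ ∑ (map H xs)
∑-⊕ F H []       w = refl
∑-⊕ F H (x ∷ xs) w = trans (cong (λ r → F x w ℤ.+ H x w ℤ.+ r) (∑-⊕ F H xs w))
  (lemma (F x w) (H x w) _ _)
  where
  lemma : ∀ a b c d → a ℤ.+ b ℤ.+ (c ℤ.+ d) ≡ a ℤ.+ c ℤ.+ (b ℤ.+ d)
  lemma = solve-∀

∑-zero : ∀ (F : A → Series n) xs w → (∀ {x} → x ∈ xs → F x w ≡ 0ℤ) → ∑ (map F xs) w ≡ 0ℤ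
∑-zero F []       w F≡0 = refl
∑-zero F (x ∷ xs) w F≡0 = cong₂ ℤ._+_ (F≡0 (here refl)) (∑-zero F xs w (F≡0 ∘ there))

∑-single : ∀ (F : A → Series n) {xs y} w → Unique xs → y ∈ xs →
           (∀ {x} → x ∈ xs → x ≢ y → F x w ≡ 0ℤ) → ∑ (map F xs) w ≡ F y w
∑-single F {y ∷ xs} w (y∉xs ∷ _) (here refl) F≡0 = trans
  (cong (λ r → F y w ℤ.+ r) (∑-zero F xs w λ x∈ → F≡0 (there x∈) (All.lookup y∉xs x∈ ∘ sym)))
  (ℤ.+-identityʳ _)
∑-single F {x ∷ xs} {y} w (x∉xs ∷ xs!) (there y∈) F≡0 = trans
  (cong₂ ℤ._+_ (F≡0 (here refl) (All.lookup x∉xs y∈)) (∑-single F w xs! y∈ (F≡0 ∘ there)))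
  (ℤ.+-identityˡ _)

module _ {P Q R : Pred A 0ℓ} (P? : Decidable P) (Q? : Decidable Q) (R? : Decidable R)
         (exactly-one : ∀ x → (P x × ¬ Q x × ¬ R x) ⊎ (¬ P x × Q x × ¬ R x) ⊎ (¬ P x × ¬ Q x × R x))
         (p : A → Laurent n) where

  -- Induction on the list: a factor of the second or third class is carried past the preceding
  -- products by `•-comm` and then absorbed into its own product.
  ∏-partition : ∀ xs f → ∏ (map p xs) • f ≗
    ∏ (map p (filter P? xs)) • (∏ (map p (filter Q? xs)) • (∏ (map p (filter R? xs)) • f))
  ∏-partition [] f w = sym (trans (x^0-• ((x^ 0ᴺ) • ((x^ 0ᴺ) • f)) w) (x^0-• ((x^ 0ᴺ) • f) w))
  ∏-partition (x ∷ xs) f w with exactly-one x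
  ... | inj₁ (px , ¬qx , ¬rx)
    rewrite filter-accept P? {xs = xs} px | filter-reject Q? {xs = xs} ¬qx | filter-reject R? {xs = xs} ¬rx = begin
    ((p x · ∏ (map p xs)) • f) w      ≡⟨ •-· (p x) (∏ (map p xs)) f w ⟩
    (p x • (∏ (map p xs) • f)) w      ≡⟨ •-cong (p x) (∏-partition xs f) w ⟩
    (p x • (a • (b • (c • f)))) w     ≡⟨ •-· (p x) a (b • (c • f)) w ⟨
    ((p x · a) • (b • (c • f))) w     ∎
    where
    open ≡-Reasoning
    a = ∏ (map p (filter P? xs))
    b = ∏ (map p (filter Q? xs))
    c = ∏ (map p (filter R? xs))
  ... | inj₂ (inj₁ (¬px , qx , ¬rx))
    rewrite filter-reject P? {xs = xs} ¬px | filter-accept Q? {xs = xs} qx | filter-reject R? {xs = xs} ¬rx = begin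
    ((p x · ∏ (map p xs)) • f) w      ≡⟨ •-· (p x) (∏ (map p xs)) f w ⟩
    (p x • (∏ (map p xs) • f)) w      ≡⟨ •-cong (p x) (∏-partition xs f) w ⟩
    (p x • (a • (b • (c • f)))) w     ≡⟨ •-comm (p x) a (b • (c • f)) w ⟩
    (a • (p x • (b • (c • f)))) w     ≡⟨ •-cong a (•-· (p x) b (c • f)) w ⟨
    (a • ((p x · b) • (c • f))) w     ∎
    where
    open ≡-Reasoning
    a = ∏ (map p (filter P? xs))
    b = ∏ (map p (filter Q? xs))
    c = ∏ (map p (filter R? xs))
  ... | inj₂ (inj₂ (¬px , ¬qx , rx))
    rewrite filter-reject P? {xs = xs} ¬px | filter-reject Q? {xs = xs} ¬qx | filter-accept R? {xs = xs} rx = begin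
    ((p x · ∏ (map p xs)) • f) w      ≡⟨ •-· (p x) (∏ (map p xs)) f w ⟩
    (p x • (∏ (map p xs) • f)) w      ≡⟨ •-cong (p x) (∏-partition xs f) w ⟩
    (p x • (a • (b • (c • f)))) w     ≡⟨ •-comm (p x) a (b • (c • f)) w ⟩
    (a • (p x • (b • (c • f)))) w     ≡⟨ •-cong a (•-comm (p x) b (c • f)) w ⟩
    (a • (b • (p x • (c • f)))) w     ≡⟨ •-cong a (•-cong b (•-· (p x) c f)) w ⟨
    (a • (b • ((p x · c) • f))) w     ∎
    where
    open ≡-Reasoning
    a = ∏ (map p (filter P? xs))
    b = ∏ (map p (filter Q? xs))
    c = ∏ (map p (filter R? xs))

-- Fractional parts

private
  toℚᵘ-/1 : ∀ z → toℚᵘ (z ℚ./ 1) ℚᵘ.≃ ℚᵘ.mkℚᵘ z 0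
  toℚᵘ-/1 z = ℚ.toℚᵘ-fromℚᵘ (ℚᵘ.mkℚᵘ z 0)

/1-homo-+ : ∀ x y → (x ℤ.+ y) ℚ./ 1 ≡ x ℚ./ 1 + y ℚ./ 1
/1-homo-+ x y = ℚ.toℚᵘ-injective (begin-equality
  toℚᵘ ((x ℤ.+ y) ℚ./ 1)                    ≃⟨ toℚᵘ-/1 (x ℤ.+ y) ⟩
  ℚᵘ.mkℚᵘ (x ℤ.+ y) 0                       ≃⟨ ℚᵘ.*≡* (lemma x y) ⟩
  ℚᵘ.mkℚᵘ x 0 ℚᵘ.+ ℚᵘ.mkℚᵘ y 0              ≃⟨ ℚᵘ.+-cong (toℚᵘ-/1 x) (toℚᵘ-/1 y) ⟨
  toℚᵘ (x ℚ./ 1) ℚᵘ.+ toℚᵘ (y ℚ./ 1)        ≃⟨ ℚ.toℚᵘ-homo-+ (x ℚ./ 1) (y ℚ./ 1) ⟨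
  toℚᵘ (x ℚ./ 1 + y ℚ./ 1)                  ∎)
  where
  open ℚᵘ.≤-Reasoning
  lemma : ∀ x y → (x ℤ.+ y) ℤ.* 1ℤ ≡ (x ℤ.* 1ℤ ℤ.+ y ℤ.* 1ℤ) ℤ.* 1ℤ
  lemma = solve-∀

/1-homo-‿- : ∀ x y → (x ℤ.- y) ℚ./ 1 ≡ x ℚ./ 1 - y ℚ./ 1
/1-homo-‿- x y = begin
  (x ℤ.- y) ℚ./ 1                            ≡⟨ solve 2 (λ a b → a := a :+ b :+ (:- b)) refl _ (y ℚ./ 1) ⟩
  (x ℤ.- y) ℚ./ 1 + y ℚ./ 1 - y ℚ./ 1        ≡⟨ cong (_- y ℚ./ 1) (/1-homo-+ (x ℤ.- y) y) ⟨
  (x ℤ.- y ℤ.+ y) ℚ./ 1 - y ℚ./ 1            ≡⟨ cong (λ z → z ℚ./ 1 - y ℚ./ 1) (lemma x y) ⟩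
  x ℚ./ 1 - y ℚ./ 1                          ∎
  where
  open ≡-Reasoning
  lemma : ∀ x y → x ℤ.- y ℤ.+ y ≡ x
  lemma = solve-∀

/1-cancel-< : ∀ {x y} → x ℚ./ 1 < y ℚ./ 1 → x ℤ.< y
/1-cancel-< {x} {y} h = subst₂ ℤ._<_ (ℤ.*-identityʳ x) (ℤ.*-identityʳ y) (ℚᵘ.drop-*<*
  (ℚᵘ.<-respˡ-≃ (toℚᵘ-/1 x) (ℚᵘ.<-respʳ-≃ (toℚᵘ-/1 y) (ℚ.toℚᵘ-mono-< h))))

x+y-y : ∀ x y → x + y - y ≡ x
x+y-y = solve 2 (λ x y → x :+ y :+ (:- y) := x) refl

x-y+y : ∀ x y → x - y + y ≡ x
x-y+y = solve 2 (λ x y → x :+ (:- y) :+ y := x) refl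

p≤q⇒0≤q-p : ∀ {p q} → p ≤ q → 0ℚ ≤ q - p
p≤q⇒0≤q-p {p} {q} p≤q = subst (_≤ q - p) (ℚ.+-inverseʳ p) (ℚ.+-monoˡ-≤ (- p) p≤q)

0≤q-p⇒p≤q : ∀ {p q} → 0ℚ ≤ q - p → p ≤ q
0≤q-p⇒p≤q {p} {q} h = subst₂ _≤_ (ℚ.+-identityˡ p) (x-y+y q p) (ℚ.+-monoˡ-≤ p h)

frac : ℚ → ℚ
frac x = x - floor x ℚ./ 1

floor-≤ : ∀ x → floor x ℚ./ 1 ≤ x
floor-≤ x@(mkℚ p d _) = ℚ.toℚᵘ-cancel-≤ (ℚᵘ.≤-respˡ-≃ (ℚᵘ.≃-sym (toℚᵘ-/1 (floor x)))
  (ℚᵘ.*≤* (subst (floor x ℤ.* + ℕ.suc d ℤ.≤_) (sym (ℤ.*-identityʳ p)) (ℤ.[n/d]*d≤n p (+ ℕ.suc d)))))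

floor-> : ∀ x → x < (1ℤ ℤ.+ floor x) ℚ./ 1
floor-> x@(mkℚ p d _) = ℚ.toℚᵘ-cancel-< (ℚᵘ.<-respʳ-≃ (ℚᵘ.≃-sym (toℚᵘ-/1 (1ℤ ℤ.+ floor x)))
  (ℚᵘ.*<* (subst₂ ℤ._<_ (sym (ℤ.*-identityʳ p))
    (cong (λ q → (1ℤ ℤ.+ q) ℤ.* + ℕ.suc d) (sym (ℤ.div-pos-is-/ℕ p (ℕ.suc d))))
    (ℤ.n<s[n/ℕd]*d p (ℕ.suc d)))))

0≤frac : ∀ x → 0ℚ ≤ frac x
0≤frac x = p≤q⇒0≤q-p (floor-≤ x)

frac<1 : ∀ x → frac x < 1ℚ
frac<1 x = subst (frac x <_) (x+y-y 1ℚ (floor x ℚ./ 1))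
  (ℚ.+-monoˡ-< (- (floor x ℚ./ 1)) (subst (x <_) (/1-homo-+ 1ℤ (floor x)) (floor-> x)))

private
  small-integer : ∀ z → -1ℤ ℤ.< z → z ℤ.< 1ℤ → z ≡ 0ℤ
  small-integer (+ 0)          _ _ = refl
  small-integer +[1+ n ]       _ (ℤ.+<+ (ℕ.s≤s ()))
  small-integer -[1+ n ]       (ℤ.-<- ()) _

-- The integer `z - floor x` equals `frac x - r`, a difference of two numbers in [0,1). It lies
-- strictly between -1 and 1 and is therefore 0.
frac-unique : ∀ {x r} z → x ≡ z ℚ./ 1 + r → 0ℚ ≤ r → r < 1ℚ → frac x ≡ r
frac-unique {x} {r} z refl 0≤r r<1 = begin
  z ℚ./ 1 + r - f ℚ./ 1      ≡⟨ solve 3 (λ z r f → z :+ r :+ (:- f) := (z :+ (:- f)) :+ r) refl (z ℚ./ 1) r (f ℚ./ 1) ⟩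
  z ℚ./ 1 - f ℚ./ 1 + r      ≡⟨ cong (_+ r) (/1-homo-‿- z f) ⟨
  (z ℤ.- f) ℚ./ 1 + r        ≡⟨ cong (λ k → k ℚ./ 1 + r) k≡0 ⟩
  0ℚ + r                     ≡⟨ ℚ.+-identityˡ r ⟩
  r                          ∎
  where
  open ≡-Reasoning
  f = floor x
  q = z ℚ./ 1 - f ℚ./ 1
  q≡ : q ≡ frac x - r
  q≡ = solve 3 (λ z r f → z :+ (:- f) := z :+ r :+ (:- f) :+ (:- r)) refl (z ℚ./ 1) r (f ℚ./ 1)
  q<1 : q < 1ℚ
  q<1 = subst₂ _<_ (sym q≡) (ℚ.+-identityʳ 1ℚ)
    (ℚ.+-mono-<-≤ (frac<1 x) (ℚ.neg-antimono-≤ 0≤r))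
  -1<q : - 1ℚ < q
  -1<q = subst₂ _<_ (ℚ.+-identityˡ (- 1ℚ)) (sym q≡) (ℚ.+-mono-≤-< (0≤frac x) (ℚ.neg-antimono-< r<1))
  k≡0 : z ℤ.- f ≡ 0ℤ
  k≡0 = small-integer (z ℤ.- f)
    (/1-cancel-< (subst (- 1ℚ <_) (sym (/1-homo-‿- z f)) -1<q))
    (/1-cancel-< (subst (_< 1ℚ) (sym (/1-homo-‿- z f)) q<1))

frac-small : ∀ {x} → 0ℚ ≤ x → x < 1ℚ → frac x ≡ x
frac-small {x} = frac-unique 0ℤ (sym (ℚ.+-identityˡ x))

frac-pred : ∀ x → frac (x - 1ℚ) ≡ frac x
frac-pred x = frac-unique (floor x ℤ.- 1ℤ) eq (0≤frac x) (frac<1 x)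
  where
  eq : x - 1ℚ ≡ (floor x ℤ.- 1ℤ) ℚ./ 1 + frac x
  eq = trans
    (solve 2 (λ x f → x :+ (:- con 1ℚ) := f :+ (:- con 1ℚ) :+ (x :+ (:- f))) refl x (floor x ℚ./ 1))
    (cong (_+ frac x) (sym (/1-homo-‿- (floor x) 1ℤ)))

-- Functions of one coordinate

pred<x : ∀ x → x - 1ℚ < x
pred<x x = subst (x - 1ℚ <_) (ℚ.+-identityʳ x) (ℚ.+-monoʳ-< x (ℚ.negative⁻¹ (- 1ℚ)))

-- This condition lets a product of one-coordinate functions detect the cone by itself: a negative
-- coordinate makes the product 0.
Vanishing : (ℚ → ℤ) → Set
Vanishing f = ∀ x → x < 0ℚ → f x ≡ 0ℤ

-- shift f and diff f are the actions of t and 1 - t on f, for t the translation by 1.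
shift diff : (ℚ → ℤ) → ℚ → ℤ
shift f x = f (x - 1ℚ)
diff f x = f x ℤ.- f (x - 1ℚ)

shift-vanishing : ∀ {f} → Vanishing f → Vanishing (shift f)
shift-vanishing v x x<0 = v (x - 1ℚ) (ℚ.<-trans (pred<x x) x<0)

diff-vanishing : ∀ {f} → Vanishing f → Vanishing (diff f)
diff-vanishing v x x<0 = cong₂ ℤ._-_ (v x x<0) (shift-vanishing v x x<0)

-- For f supported on [0,1), periodic f is the expansion of f / (1 - t).
periodic : (ℚ → ℤ) → ℚ → ℤ
periodic f x with 0ℚ ℚ.≤? x
... | yes _ = f (frac x)
... | no  _ = 0ℤ

periodic-≥0 : ∀ f {x} → 0ℚ ≤ x → periodic f x ≡ f (frac x)
periodic-≥0 f {x} 0≤x with 0ℚ ℚ.≤? x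
... | yes _   = refl
... | no  0≰x = contradiction 0≤x 0≰x

periodic-vanishing : ∀ f → Vanishing (periodic f)
periodic-vanishing f x x<0 with 0ℚ ℚ.≤? x
... | yes 0≤x = contradiction (ℚ.<-≤-trans x<0 0≤x) (ℚ.<-irrefl refl)
... | no  _   = refl

-- For x ≥ 1 the values at x and x - 1 have the same fractional part and cancel. For 0 ≤ x < 1 only
-- the first one survives, and there `frac x` is x. For x < 0 both are 0.
diff-periodic : ∀ f → Vanishing f → (∀ x → 1ℚ ≤ x → f x ≡ 0ℤ) → diff (periodic f) ≗ f
diff-periodic f below above x with 0ℚ ℚ.≤? x | 0ℚ ℚ.≤? x - 1ℚ
... | yes 0≤x | yes 1≤x = trans (cong (λ r → f (frac x) ℤ.- f r) (frac-pred x))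
  (trans (ℤ.+-inverseʳ (f (frac x))) (sym (above x (0≤q-p⇒p≤q 1≤x))))
... | yes 0≤x | no  1≰x = trans (ℤ.+-identityʳ _) (cong f (frac-small 0≤x
  (ℚ.≰⇒> (1≰x ∘ p≤q⇒0≤q-p))))
... | no  0≰x | yes 1≤x = contradiction
  (ℚ.≤-trans (ℚ.nonNegative⁻¹ 1ℚ) (0≤q-p⇒p≤q 1≤x)) 0≰x
... | no  0≰x | no  _   = sym (below x (ℚ.≰⇒> 0≰x))

-- Coordinate vectors and linear combinations

unit : Fin m → Vector ℚ m
unit i = updateAt (λ _ → 0ℚ) i (const 1ℚ)

sum-- : ∀ (a b : Vector ℚ m) → sum (λ i → a i - b i) ≡ sum a - sum b
sum-- {ℕ.zero}  a b = refl
sum-- {ℕ.suc m} a b = trans (cong (λ r → a zero - b zero + r) (sum-- (a ∘ suc) (b ∘ suc)))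
  (solve 4 (λ x y z w → x :+ (:- y) :+ (z :+ (:- w)) := x :+ z :+ (:- (y :+ w))) refl
    (a zero) (b zero) _ _)

sum-0* : ∀ (x : Vector ℚ m) → sum (λ j → 0ℚ * x j) ≡ 0ℚ
sum-0* x = trans (sym (*-distribˡ-sum 0ℚ x)) (ℚ.*-zeroˡ (sum x))

sum-unit : ∀ i (x : Vector ℚ m) → sum (λ j → unit i j * x j) ≡ x i
sum-unit zero    x = trans (cong₂ _+_ (ℚ.*-identityˡ (x zero)) (sum-0* (x ∘ suc))) (ℚ.+-identityʳ _)
sum-unit (suc i) x = trans (cong₂ _+_ (ℚ.*-zeroˡ (x zero)) (sum-unit i (x ∘ suc))) (ℚ.+-identityˡ _)

point-- : ∀ (w u : Lattice n) k → point (w -ᴺ u) k ≡ point w k - point u k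
point-- w u k = trans (cong (ℚ._/ 1) (Vec.lookup-zipWith ℤ._-_ k w u))
  (/1-homo-‿- (lookup w k) (lookup u k))

module _ (g : Fin m → Lattice n) where

  combination-- : ∀ a b k → combination g (λ i → a i - b i) k ≡ combination g a k - combination g b k
  combination-- a b k = trans
    (sum-cong-≗ λ i → lemma (a i) (b i) (point (g i) k))
    (sum-- (λ i → a i * point (g i) k) (λ i → b i * point (g i) k))
    where
    lemma : ∀ a b x → (a - b) * x ≡ a * x - b * x
    lemma = solve 3 (λ a b x → (a :+ (:- b)) :* x := a :* x :+ (:- (b :* x))) refl

  combination-cong : ∀ {a b} → a ≗ b → combination g a ≗ combination g b
  combination-cong a≗b k = sum-cong-≗ λ i → cong (_* point (g i) k) (a≗b i)

  combination-unit : ∀ i → combination g (unit i) ≗ point (g i)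
  combination-unit i k = sum-unit i λ j → point (g j) k

-- Products of one-coordinate functions

prod-zero : ∀ {t : Vector ℤ m} i → t i ≡ 0ℤ → prod t ≡ 0ℤ
prod-zero {t = t} zero    t≡0 = cong (ℤ._* prod (t ∘ suc)) t≡0
prod-zero {t = t} (suc i) t≡0 = trans (cong (t zero ℤ.*_) (prod-zero {t = t ∘ suc} i t≡0)) (ℤ.*-zeroʳ (t zero))

prod-one : ∀ {t : Vector ℤ m} → (∀ i → t i ≡ 1ℤ) → prod t ≡ 1ℤ
prod-one {ℕ.zero}  t≡1 = refl
prod-one {ℕ.suc m} t≡1 = cong₂ ℤ._*_ (t≡1 zero) (prod-one (t≡1 ∘ suc))

-- A product is linear in its i-th factor.
prod-diff : ∀ i (φ : Vector (ℚ → ℤ) m) (a : Vector ℚ m) →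
  prod (λ j → updateAt φ i diff j (a j)) ≡
  prod (λ j → φ j (a j)) ℤ.- prod (λ j → updateAt φ i shift j (a j))
prod-diff zero φ a = lemma (φ zero (a zero)) _ _
  where
  lemma : ∀ x y z → (x ℤ.- y) ℤ.* z ≡ x ℤ.* z ℤ.- y ℤ.* z
  lemma = solve-∀
prod-diff (suc i) φ a = trans (cong (φ zero (a zero) ℤ.*_) (prod-diff i (φ ∘ suc) (a ∘ suc)))
  (lemma (φ zero (a zero)) _ _)
  where
  lemma : ∀ x y z → x ℤ.* (y ℤ.- z) ≡ x ℤ.* y ℤ.- x ℤ.* z
  lemma = solve-∀

-- Moves the translation from the i-th function to the i-th coordinate, where it becomes subtraction
-- of the i-th generator from the point.
prod-shift : ∀ i (φ : Vector (ℚ → ℤ) m) (a : Vector ℚ m) →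
  prod (λ j → updateAt φ i shift j (a j)) ≡ prod (λ j → φ j (a j - unit i j))
prod-shift i φ a = prod-cong step
  where
  step : ∀ j → updateAt φ i shift j (a j) ≡ φ j (a j - unit i j)
  step j with j ≟ i
  ... | yes refl = trans (cong (λ f → f (a j)) (updateAt-updates j φ))
    (cong (λ x → φ j (a j - x)) (sym (updateAt-updates j (λ _ → 0ℚ))))
  ... | no j≢i = trans (cong (λ f → f (a j)) (updateAt-minimal j i φ j≢i))
    (cong (φ j) (trans (sym (ℚ.+-identityʳ (a j)))
      (cong (λ r → a j - r) (sym (updateAt-minimal j i (λ _ → 0ℚ) j≢i)))))

-- Weighted lattice points of a simplicial cone

updateAt-∀ : ∀ {ℓ} {A : Set} (P : A → Set ℓ) {φ : Vector A m} i {f} →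
             (P (φ i) → P (f (φ i))) → (∀ j → P (φ j)) → ∀ j → P (updateAt φ i f j)
updateAt-∀ P {φ} i h Pφ j with j ≟ i
... | yes refl = subst P (sym (updateAt-updates j φ)) (h (Pφ j))
... | no j≢i = subst P (sym (updateAt-minimal j i φ j≢i)) (Pφ j)

module _ (g : Fin m → Lattice n) (c : Subset m) where

  -- The coordinates are read off whichever witness the decision carries. For independent generators
  -- the choice does not matter, by `coordinates-unique`.
  weight : Vector (ℚ → ℤ) m → ∀ {p} → Dec (coneOf g c p) → ℤ
  weight φ (yes (a , _)) = prod λ i → φ i (a i)
  weight φ (no _)        = 0ℤ

  weight-outside : ∀ φ {p} (d : Dec (coneOf g c p)) → ¬ coneOf g c p → weight φ d ≡ 0ℤ
  weight-outside φ (yes ∈cone) ∉cone = contradiction ∈cone ∉cone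
  weight-outside φ (no _)      ∉cone = refl

  abstract
    -- Opaque, so that the elimination procedure behind `coneOf?` does not unfold.
    ∈cone? : ∀ w → Dec (coneOf g c (point w))
    ∈cone? w = coneOf? g c (point w)

    -- The coefficient of x^w for w = Σ aᵢ gᵢ in the cone is ∏ φᵢ(aᵢ).
    series : Vector (ℚ → ℤ) m → Series n
    series φ w = weight φ (∈cone? w)

    series-weight : ∀ φ w → series φ w ≡ weight φ (∈cone? w)
    series-weight φ w = refl

  series-outside : ∀ φ w → ¬ coneOf g c (point w) → series φ w ≡ 0ℤ
  series-outside φ w ∉cone = trans (series-weight φ w) (weight-outside φ (∈cone? w) ∉cone)

module Simplicial (g : Fin m → Lattice n) (c : Subset m) (independent : LinearlyIndependent g c) where

  Supported : Vector ℚ m → Set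
  Supported a = ∀ i → i ∉ c → a i ≡ 0ℚ

  coordinates-unique : ∀ {a b p} → Supported a → Supported b →
                       combination g a ≗ p → combination g b ≗ p → a ≗ b
  coordinates-unique {a} {b} {p} sa sb ca cb i = trans (sym (x-y+y (a i) (b i)))
    (trans (cong (_+ b i) (independent (λ i → a i - b i)
      (λ i i∉c → cong₂ _-_ (sa i i∉c) (sb i i∉c))
      (λ k → trans (combination-- g a b k) (trans (cong₂ _-_ (ca k) (cb k)) (ℚ.+-inverseʳ (p k)))) i))
    (ℚ.+-identityˡ (b i)))

  -- The coordinates `a` may be negative. If the point is outside the cone then some coordinate is
  -- negative, and `Vanishing` turns the product into the 0 that `weight` assigns.
  weight-eval : ∀ {φ} → (∀ i → Vanishing (φ i)) → ∀ {a p} (d : Dec (coneOf g c p)) → Supported a →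
                combination g a ≗ p → weight g c φ d ≡ prod λ i → φ i (a i)
  weight-eval {φ} vanish (yes (b , sb , _ , cb)) sa ca =
    prod-cong λ i → cong (φ i) (coordinates-unique sb sa cb ca i)
  weight-eval {φ} vanish {a} (no ∉cone) sa ca with all? (λ i → 0ℚ ℚ.≤? a i)
  ... | yes a≥0 = contradiction (a , sa , a≥0 , ca) ∉cone
  ... | no ¬a≥0 with ¬∀⟶∃¬ m _ (λ i → 0ℚ ℚ.≤? a i) ¬a≥0
  ...   | i , a≱0 = sym (prod-zero i (vanish i (a i) (ℚ.≰⇒> a≱0)))

  series-eval : ∀ {φ} → (∀ i → Vanishing (φ i)) → ∀ {a} w → Supported a →
                combination g a ≗ point w → series g c φ w ≡ prod λ i → φ i (a i)
  series-eval {φ} vanish w sa ca = trans (series-weight g c φ w) (weight-eval vanish (∈cone? g c w) sa ca)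

  -- The coordinates off c are 0, so only the values φᵢ(0) matter there.
  Agree : Vector (ℚ → ℤ) m → Vector (ℚ → ℤ) m → Fin m → Set
  Agree φ ψ i = ∀ x → (i ∉ c → x ≡ 0ℚ) → φ i x ≡ ψ i x

  series-cong : ∀ {φ ψ} → (∀ i → Vanishing (φ i)) → (∀ i → Vanishing (ψ i)) →
                (∀ i → Agree φ ψ i) → series g c φ ≗ series g c ψ
  series-cong vφ vψ φ≗ψ w with ∈cone? g c w
  ... | yes (a , sa , _ , ca) = trans (series-eval vφ w sa ca)
    (trans (prod-cong λ i → φ≗ψ i (a i) (sa i)) (sym (series-eval vψ w sa ca)))
  ... | no ∉cone = trans (series-outside g c _ w ∉cone) (sym (series-outside g c _ w ∉cone))

  module _ {φ : Vector (ℚ → ℤ) m} (vanish : ∀ i → Vanishing (φ i)) {i : Fin m} (i∈c : i ∈ₛ c) where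

    shift-update-vanishing : ∀ j → Vanishing (updateAt φ i shift j)
    shift-update-vanishing = updateAt-∀ Vanishing i shift-vanishing vanish

    diff-update-vanishing : ∀ j → Vanishing (updateAt φ i diff j)
    diff-update-vanishing = updateAt-∀ Vanishing i diff-vanishing vanish

    unit-supported : Supported (unit i)
    unit-supported j j∉c = updateAt-minimal j i (λ _ → 0ℚ) λ { refl → j∉c i∈c }

    -- For w in the cone, subtracting gᵢ lowers the i-th coordinate by 1; should it become negative,
    -- `series-eval` still applies. For w outside, w - gᵢ is outside too, since adding gᵢ stays in
    -- the cone.
    x^-series : (x^ g i) • series g c φ ≗ series g c (updateAt φ i shift)
    x^-series w with ∈cone? g c w
    ... | yes (a , sa , _ , ca) = begin
      ((x^ g i) • series g c φ) w                      ≡⟨ x^-• (g i) (series g c φ) w ⟩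
      series g c φ (w -ᴺ g i)                          ≡⟨ series-eval vanish (w -ᴺ g i) a-unit-supported a-unit-point ⟩
      prod (λ j → φ j (a j - unit i j))            ≡⟨ prod-shift i φ a ⟨
      prod (λ j → updateAt φ i shift j (a j))      ≡⟨ series-eval shift-update-vanishing w sa ca ⟨
      series g c (updateAt φ i shift) w                ∎
      where
      open ≡-Reasoning
      a-unit-supported : Supported (λ j → a j - unit i j)
      a-unit-supported j j∉c = cong₂ _-_ (sa j j∉c) (unit-supported j j∉c)
      a-unit-point : combination g (λ j → a j - unit i j) ≗ point (w -ᴺ g i)
      a-unit-point k = trans (combination-- g a (unit i) k)
        (trans (cong₂ _-_ (ca k) (combination-unit g i k)) (sym (point-- w (g i) k)))
    ... | no ∉cone = trans (x^-• (g i) (series g c φ) w)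
      (trans (series-outside g c φ (w -ᴺ g i) (∉cone ∘ translate)) (sym (series-outside g c _ w ∉cone)))
      where
      translate : coneOf g c (point (w -ᴺ g i)) → coneOf g c (point w)
      -- Adding gᵢ is written as subtracting its negative, so that `combination--` serves here as
      -- well.
      translate (a , sa , a≥0 , ca) = (λ j → a j - - unit i j)
        , (λ j j∉c → cong₂ (λ x y → x - - y) (sa j j∉c) (unit-supported j j∉c))
        , (λ j → ℚ.+-mono-≤ (a≥0 j) (subst (0ℚ ≤_) (sym (neg² (unit i j))) (unit≥0 j)))
        , λ k → begin
          combination g (λ j → a j - - unit i j) k
            ≡⟨ combination-- g a (λ j → - unit i j) k ⟩
          combination g a k - combination g (λ j → - unit i j) k
            ≡⟨ cong₂ _-_ (trans (ca k) (point-- w (g i) k)) (neg-unit k) ⟩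
          point w k - point (g i) k - - point (g i) k
            ≡⟨ x+y-y (point w k) (- point (g i) k) ⟩
          point w k ∎
        where
        open ≡-Reasoning
        neg² : ∀ x → - - x ≡ x
        neg² = solve 1 (λ x → :- (:- x) := x) refl
        unit≥0 : ∀ j → 0ℚ ≤ unit i j
        unit≥0 = updateAt-∀ (0ℚ ≤_) i (λ _ → ℚ.nonNegative⁻¹ 1ℚ) (λ _ → ℚ.≤-refl)
        neg-unit : ∀ k → combination g (λ j → - unit i j) k ≡ - point (g i) k
        neg-unit k = trans (combination-cong g (λ j → sym (ℚ.+-identityˡ (- unit i j))) k)
          (trans (combination-- g (λ _ → 0ℚ) (unit i) k)
            (trans (cong₂ _-_ (sum-0* λ j → point (g j) k) (combination-unit g i k)) (ℚ.+-identityˡ _)))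

    1-x^-series : (1-x^ g i) • series g c φ ≗ series g c (updateAt φ i diff)
    1-x^-series w = begin
      ((1-x^ g i) • series g c φ) w                          ≡⟨ 1-x^-• (g i) (series g c φ) w ⟩
      series g c φ w ℤ.- series g c φ (w -ᴺ g i)                 ≡⟨ cong (λ x → series g c φ w ℤ.- x) (x^-• (g i) (series g c φ) w) ⟨
      series g c φ w ℤ.- ((x^ g i) • series g c φ) w             ≡⟨ cong (λ x → series g c φ w ℤ.- x) (x^-series w) ⟩
      series g c φ w ℤ.- series g c (updateAt φ i shift) w       ≡⟨ linear ⟩
      series g c (updateAt φ i diff) w                       ∎
      where
      open ≡-Reasoning
      linear : series g c φ w ℤ.- series g c (updateAt φ i shift) w ≡ series g c (updateAt φ i diff) w
      linear with ∈cone? g c w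
      ... | yes (a , sa , _ , ca) = trans
        (cong₂ ℤ._-_ (series-eval vanish w sa ca) (series-eval shift-update-vanishing w sa ca))
        (trans (sym (prod-diff i φ a)) (sym (series-eval diff-update-vanishing w sa ca)))
      ... | no ∉cone = trans
        (cong₂ ℤ._-_ (series-outside g c _ w ∉cone) (series-outside g c _ w ∉cone))
        (sym (series-outside g c _ w ∉cone))

  -- The operator `T` stands for `shift` or `diff`. As the indices are distinct, each factor changes
  -- its own coordinate function once. Off the list only `Agree` is asked, because `φ` and `ψ` may
  -- differ at values that a coordinate off `c` never takes.
  ∏-series : (p : Fin m → Laurent n) (T : (ℚ → ℤ) → ℚ → ℤ) →
    (∀ {φ} → (∀ i → Vanishing (φ i)) → ∀ {i} → i ∈ₛ c → p i • series g c φ ≗ series g c (updateAt φ i T)) →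
    ∀ {is} → Unique is → (∀ {i} → i ∈ is → i ∈ₛ c) →
    ∀ {φ ψ} → (∀ i → Vanishing (φ i)) → (∀ i → Vanishing (ψ i)) →
    (∀ {i} → i ∈ is → ψ i ≗ T (φ i)) → (∀ {i} → ¬ i ∈ is → Agree ψ φ i) →
    ∏ (map p is) • series g c φ ≗ series g c ψ
  ∏-series p T act {[]} _ _ {φ} vφ vψ _ ψ≗φ w = trans (x^0-• (series g c φ) w)
    (series-cong vφ vψ (λ i x x≡0 → sym (ψ≗φ (λ ()) x x≡0)) w)
  ∏-series p T act {j ∷ is} (j∉is ∷ is!) is⊆c {φ} {ψ} vφ vψ ψ≗Tφ ψ≗φ w = begin
    ((p j · ∏ (map p is)) • series g c φ) w      ≡⟨ •-· (p j) (∏ (map p is)) (series g c φ) w ⟩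
    (p j • (∏ (map p is) • series g c φ)) w      ≡⟨ •-cong (p j) (∏-series p T act is! (is⊆c ∘ there) vφ vχ on off) w ⟩
    (p j • series g c χ) w                       ≡⟨ act vχ (is⊆c (here refl)) w ⟩
    series g c (updateAt χ j T) w                ≡⟨ series-cong vTχ vψ (λ i x _ → Tχ≗ψ i x) w ⟩
    series g c ψ w                               ∎
    where
    open ≡-Reasoning
    -- The intermediate weights: all factors except the j-th have acted, so the j-th entry is still
    -- that of `φ`.
    χ = updateAt ψ j (const (φ j))
    vχ : ∀ i → Vanishing (χ i)
    vχ = updateAt-∀ Vanishing j (λ _ → vφ j) vψ
    χj : χ j ≡ φ j
    χj = updateAt-updates j ψ
    on : ∀ {i} → i ∈ is → χ i ≗ T (φ i)
    on {i} i∈is x = trans (cong (λ f → f x) (updateAt-minimal i j ψ λ { refl → All.lookup j∉is i∈is refl }))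
      (ψ≗Tφ (there i∈is) x)
    off : ∀ {i} → ¬ i ∈ is → Agree χ φ i
    off {i} i∉is x x≡0 with i ≟ j
    ... | yes refl = cong (λ f → f x) χj
    ... | no i≢j = trans (cong (λ f → f x) (updateAt-minimal i j ψ i≢j))
      (ψ≗φ (λ { (here i≡j) → i≢j i≡j ; (there i∈is) → i∉is i∈is }) x x≡0)
    Tχ≗ψ : ∀ i → updateAt χ j T i ≗ ψ i
    Tχ≗ψ i x with i ≟ j
    ... | yes refl = trans (cong (λ f → f x) (updateAt-updates j χ))
      (trans (cong (λ f → T f x) χj) (sym (ψ≗Tφ (here refl) x)))
    ... | no i≢j = cong (λ f → f x) (trans (updateAt-minimal i j χ i≢j) (updateAt-minimal i j ψ i≢j))
    vTχ : ∀ i → Vanishing (updateAt χ j T i)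
    vTχ i x x<0 = trans (Tχ≗ψ i x) (vψ i x x<0)

-- Subsets and indicators

module _ {P : Pred (Fin m) 0ℓ} (P? : Decidable P) where

  comprehension : Subset m
  comprehension = tabulate (does ∘ P?)

  ∈-comprehension⁺ : ∀ {i} → P i → i ∈ₛ comprehension
  ∈-comprehension⁺ {i} p = Vec.lookup⇒[]= i comprehension
    (trans (Vec.lookup∘tabulate (does ∘ P?) i) (dec-true (P? i) p))

  ∈-comprehension⁻ : ∀ {i} → i ∈ₛ comprehension → P i
  ∈-comprehension⁻ {i} i∈ with P? i | trans (sym (Vec.lookup∘tabulate (does ∘ P?) i)) (Vec.[]=⇒lookup i∈)
  ... | yes p | _ = p

∩≡⊥⁻ : ∀ {p q : Subset m} → p ∩ q ≡ ⊥ → ∀ {i} → i ∈ₛ p → i ∉ q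
∩≡⊥⁻ p∩q≡⊥ i∈p i∈q = ∉⊥ (subst (_ ∈ₛ_) p∩q≡⊥ (x∈p∩q⁺ (i∈p , i∈q)))

∩≡⊥⁺ : ∀ {p q : Subset m} → (∀ {i} → i ∈ₛ p → i ∉ q) → p ∩ q ≡ ⊥
∩≡⊥⁺ {p = p} {q} disjoint = Empty-unique λ (i , i∈) →
  let i∈p , i∈q = x∈p∩q⁻ p q i∈ in disjoint i∈p i∈q

indicator : {A : Set} {P : Pred A 0ℓ} → Decidable P → A → ℤ
indicator P? x with P? x
... | yes _ = 1ℤ
... | no  _ = 0ℤ

module _ {A : Set} {P : Pred A 0ℓ} (P? : Decidable P) {x : A} where

  indicator-true : P x → indicator P? x ≡ 1ℤ
  indicator-true p with P? x
  ... | yes _ = refl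
  ... | no ¬p = contradiction p ¬p

  indicator-false : ¬ P x → indicator P? x ≡ 0ℤ
  indicator-false ¬p with P? x
  ... | yes p = contradiction p ¬p
  ... | no  _ = refl

module _ {P : Pred (Lattice n) 0ℓ} (P? : Decidable P) (w : Lattice n) where

  genFun-true : P w → genFun P? w ≡ 1ℤ
  genFun-true p with P? w
  ... | yes _ = refl
  ... | no ¬p = contradiction p ¬p

  genFun-false : ¬ P w → genFun P? w ≡ 0ℤ
  genFun-false ¬p with P? w
  ... | yes p = contradiction p ¬p
  ... | no  _ = refl

-- Links and stars

module Fan (Δ : SimplicialFan n) where
  open SimplicialFan Δ

  -- Climb to a strictly larger cone as long as there is one. This ends because strict inclusion is
  -- well-founded on subsets of a finite set.
  maximal-above : ∀ {τ} → τ ∈ cones → ∃ λ μ → Maximal Δ μ × τ ⊆ μ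
  maximal-above {τ} = go (⊃-wellFounded τ)
    where
    go : ∀ {τ} → Acc _⊃_ τ → τ ∈ cones → ∃ λ μ → Maximal Δ μ × τ ⊆ μ
    go {τ} (acc rec) τ∈ with any? (τ ⊂?_) cones
    ... | yes larger = let ν , ν∈ , τ⊂ν = find larger
                           μ , max , ν⊆μ = go (rec τ⊂ν) ν∈
                       in μ , max , ⊆-trans (proj₁ τ⊂ν) ν⊆μ
    ... | no ¬larger = τ , (τ∈ , All.tabulate maximal) , ⊆-refl
      where
      maximal : ∀ {ν} → ν ∈ cones → τ ⊆ ν → τ ≡ ν
      maximal {ν} ν∈ τ⊆ν = ⊆-antisym τ⊆ν λ {i} i∈ν →
        decidable-stable (i ∈? τ) λ i∉τ → ¬larger (lose ν∈ (τ⊆ν , i , i∈ν , i∉τ))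

  module _ {τ : Subset rays} (τ∈ : τ ∈ cones) where

    rayOfStar⁺ : ∀ {c} → c ∈ cones → τ ⊆ c → ∀ {j} → j ∈ₛ c → RayOfStar Δ τ j
    rayOfStar⁺ c∈ τ⊆c j∈c = let μ , max , c⊆μ = maximal-above c∈ in
      lose (proj₁ max) (max , ⊆-trans τ⊆c c⊆μ , c⊆μ j∈c)

    -- The ray of vⱼ is itself a cone of the link: its sum with `τ` is a face of the maximal cone
    -- that contains both.
    rayOfStar⁻ : ∀ {j} → RayOfStar Δ τ j → j ∉ τ → RayOfLink Δ τ j
    rayOfStar⁻ {j} star j∉τ with find star
    ... | μ , μ∈ , _ , τ⊆μ , j∈μ = lose (ray∈ j) ((ray∈ j , ∩≡⊥⁺ disjoint , face-closed μ∈ within) , x∈⁅x⁆ j)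
      where
      disjoint : ∀ {i} → i ∈ₛ ⁅ j ⁆ → i ∉ τ
      disjoint i∈⁅j⁆ i∈τ = j∉τ (subst (_∈ₛ τ) (x∈⁅y⁆⇒x≡y j i∈⁅j⁆) i∈τ)
      within : ⁅ j ⁆ ∪ τ ⊆ μ
      within i∈ with x∈p∪q⁻ ⁅ j ⁆ τ i∈
      ... | inj₁ i∈⁅j⁆ = subst (_∈ₛ μ) (sym (x∈⁅y⁆⇒x≡y j i∈⁅j⁆)) j∈μ
      ... | inj₂ i∈τ   = τ⊆μ i∈τ

    rayOfLink⇒rayOfStar : ∀ {j} → RayOfLink Δ τ j → RayOfStar Δ τ j
    rayOfLink⇒rayOfStar link = let γ , _ , (_ , _ , γ∪τ∈) , j∈γ = find link in
      rayOfStar⁺ γ∪τ∈ (q⊆p∪q γ τ) (p⊆p∪q τ j∈γ)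

    rayOfLink⇒∉ : ∀ {j} → RayOfLink Δ τ j → j ∉ τ
    rayOfLink⇒∉ link = let γ , _ , (_ , γ∩τ≡⊥ , _) , j∈γ = find link in ∩≡⊥⁻ γ∩τ≡⊥ j∈γ

    -- The rays of Star τ are those of `τ` and those of lk τ, and `γ` is part of the link. This
    -- sorts the factors 1 - x^vⱼ for use in `∏-partition`.
    ray-trichotomy : ∀ {γ} → InLink Δ τ γ → ∀ j →
      let L = RayOfLink Δ τ j × j ∉ γ
          S = ¬ RayOfStar Δ τ j
          C = j ∈ₛ γ ∪ τ
      in (L × ¬ S × ¬ C) ⊎ (¬ L × S × ¬ C) ⊎ (¬ L × ¬ S × C)
    ray-trichotomy {γ} γ∈lk@(γ∈ , γ∩τ≡⊥ , γ∪τ∈) j with j ∈? γ ∪ τ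
    ... | yes j∈ = inj₂ (inj₂
      ( (λ (link , j∉γ) → [ j∉γ , rayOfLink⇒∉ link ]′ (x∈p∪q⁻ γ τ j∈))
      , (λ ¬star → ¬star (rayOfStar⁺ γ∪τ∈ (q⊆p∪q γ τ) j∈))
      , j∈ ))
    ... | no j∉ with rayOfStar? Δ τ j
    ...   | yes star = inj₁ ((rayOfStar⁻ star (j∉ ∘ q⊆p∪q γ τ) , j∉ ∘ p⊆p∪q τ) , (λ ¬star → ¬star star) , j∉)
    ...   | no ¬star = inj₂ (inj₁ ((λ (link , _) → ¬star (rayOfLink⇒rayOfStar link)) , ¬star , j∉))

  ∏over-series : ∀ {P : Pred (Fin rays) 0ℓ} (P? : Decidable P) (p : Lattice n → Laurent n) T {c}
    (c∈ : c ∈ cones) → (∀ {i} → P i → i ∈ₛ c) →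
    (∀ {φ} → (∀ i → Vanishing (φ i)) → ∀ {i} → i ∈ₛ c →
      p (v i) • series v c φ ≗ series v c (updateAt φ i T)) →
    ∀ {φ ψ} → (∀ i → Vanishing (φ i)) → (∀ i → Vanishing (ψ i)) →
    (∀ {i} → P i → ψ i ≗ T (φ i)) →
    (∀ {i} → ¬ P i → Simplicial.Agree v c (simplicial c∈) ψ φ i) →
    ∏over Δ P? p • series v c φ ≗ series v c ψ
  ∏over-series P? p T {c} c∈ P⊆c act vφ vψ on off =
    Simplicial.∏-series v c (simplicial c∈) (p ∘ v) T act
      (filter⁺ P? (allFin⁺ rays))
      (P⊆c ∘ proj₂ ∘ ∈-filter⁻ P? {xs = allFin rays})
      vφ vψ
      (on ∘ proj₂ ∘ ∈-filter⁻ P? {xs = allFin rays})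
      (λ i∉ → off (i∉ ∘ ∈-filter⁺ P? (∈-allFin _)))

  -- A common point lies in the common face spanned by `c ∩ c′`. Its coordinates there are supported
  -- on both cones, so independence in each cone identifies them with `a` and with `b`.
  coordinates-agree : ∀ {c c′} → c ∈ cones → c′ ∈ cones → ∀ {p} →
    ((a , _) : coneOf v c p) ((b , _) : coneOf v c′ p) → a ≗ b
  coordinates-agree {c} {c′} c∈ c′∈ {p} A@(a , sa , a≥0 , ca) B@(b , sb , b≥0 , cb) i
    with ∩-face c∈ c′∈ p A B
  ... | d , sd , _ , cd = trans
    (Simplicial.coordinates-unique v c (simplicial c∈) sa (λ i i∉c → sd i (i∉c ∘ proj₁ ∘ x∈p∩q⁻ c c′)) ca cd i)
    (Simplicial.coordinates-unique v c′ (simplicial c′∈) (λ i i∉c′ → sd i (i∉c′ ∘ proj₂ ∘ x∈p∩q⁻ c c′)) sb cd cb i)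

  -- Boxes

  module WithBase (ρ : Subset rays) where

    -- The box is a product of conditions on single coordinates. An index off `τ` gets the condition
    -- x = 0, so that all rays are treated alike.
    InBox : Subset rays → Fin rays → Pred ℚ 0ℓ
    InBox τ i x = 0ℚ ≤ x × x < 1ℚ × (i ∉ τ → x ≡ 0ℚ) × (i ∈ₛ τ → i ∉ ρ → x ≢ 0ℚ)

    inBox? : ∀ τ i → Decidable (InBox τ i)
    inBox? τ i x = (0ℚ ℚ.≤? x) ×-dec (x ℚ.<? 1ℚ) ×-dec (¬? (i ∈? τ) →-dec (x ℚ.≟ 0ℚ))
      ×-dec ((i ∈? τ) →-dec (¬? (i ∈? ρ) →-dec ¬? (x ℚ.≟ 0ℚ)))

    boxWeight : Subset rays → Vector (ℚ → ℤ) rays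
    boxWeight τ i = indicator (inBox? τ i)

    boxWeight-vanishing : ∀ τ i → Vanishing (boxWeight τ i)
    boxWeight-vanishing τ i x x<0 = indicator-false (inBox? τ i) λ (0≤x , _) →
      ℚ.<-irrefl refl (ℚ.<-≤-trans x<0 0≤x)

    boxWeight-≥1 : ∀ τ i x → 1ℚ ≤ x → boxWeight τ i x ≡ 0ℤ
    boxWeight-≥1 τ i x 1≤x = indicator-false (inBox? τ i) λ (_ , x<1 , _) →
      ℚ.<-irrefl refl (ℚ.<-≤-trans x<1 1≤x)

    -- The indicator of the non-negative integers for i ∉ τ, of the positive non-integers for i in
    -- `τ` but not in `ρ`, and of all non-negative numbers for i in both.
    tilingWeight : Subset rays → Vector (ℚ → ℤ) rays
    tilingWeight τ i = periodic (boxWeight τ i)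

    tilingWeight-vanishing : ∀ τ i → Vanishing (tilingWeight τ i)
    tilingWeight-vanishing τ i = periodic-vanishing (boxWeight τ i)

    -- When γ ∈ lk τ, an index in `γ` is off `τ`, and the shift leaves the indicator of the positive
    -- integers.
    shiftedWeight : Subset rays → Subset rays → Vector (ℚ → ℤ) rays
    shiftedWeight τ γ i with i ∈? γ
    ... | yes _ = shift (tilingWeight τ i)
    ... | no  _ = tilingWeight τ i

    shiftedWeight-∈ : ∀ τ {γ i} → i ∈ₛ γ → shiftedWeight τ γ i ≡ shift (tilingWeight τ i)
    shiftedWeight-∈ τ {γ} {i} i∈γ with i ∈? γ
    ... | yes _  = refl
    ... | no i∉γ = contradiction i∈γ i∉γ

    shiftedWeight-∉ : ∀ τ {γ i} → i ∉ γ → shiftedWeight τ γ i ≡ tilingWeight τ i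
    shiftedWeight-∉ τ {γ} {i} i∉γ with i ∈? γ
    ... | yes i∈γ = contradiction i∈γ i∉γ
    ... | no _    = refl

    shiftedWeight-vanishing : ∀ τ γ i → Vanishing (shiftedWeight τ γ i)
    shiftedWeight-vanishing τ γ i with i ∈? γ
    ... | yes _ = shift-vanishing (tilingWeight-vanishing τ i)
    ... | no  _ = tilingWeight-vanishing τ i

    abstract
      boxSeries : Subset rays → Series n
      boxSeries τ = genFun λ w → box? Δ τ ρ (point w)

      boxSeries-true : ∀ τ w → Box Δ τ ρ (point w) → boxSeries τ w ≡ 1ℤ
      boxSeries-true τ w = genFun-true (λ w → box? Δ τ ρ (point w)) w

      boxSeries-false : ∀ τ w → ¬ Box Δ τ ρ (point w) → boxSeries τ w ≡ 0ℤ
      boxSeries-false τ w = genFun-false (λ w → box? Δ τ ρ (point w)) w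

      inBoxSet? : ∀ τ w → Dec (Box Δ τ ρ (point w))
      inBoxSet? τ w = box? Δ τ ρ (point w)

      B-true : ∀ τ w → Box Δ τ ρ (point w) → w ≢ 0ᴺ → B Δ τ ρ w ≡ 1ℤ
      B-true τ w box w≢0 = genFun-true (λ w → box? Δ τ ρ (point w) ×-dec ¬? (w ≟ᴺ 0ᴺ)) w (box , w≢0)

      B-false : ∀ τ w → ¬ (Box Δ τ ρ (point w) × w ≢ 0ᴺ) → B Δ τ ρ w ≡ 0ℤ
      B-false τ w = genFun-false (λ w → box? Δ τ ρ (point w) ×-dec ¬? (w ≟ᴺ 0ᴺ)) w

    module _ {τ γ : Subset rays} (γ∪τ∈ : γ ∪ τ ∈ cones) where
      private
        c = γ ∪ τ
        module S = Simplicial v c (simplicial γ∪τ∈)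

      -- The weights force every coordinate off `τ` to be 0, so the series does not depend on `γ`
      -- although it is computed in the cone γ ∪ τ.
      series-boxWeight : series v c (boxWeight τ) ≗ boxSeries τ
      series-boxWeight w = go (inBoxSet? τ w) (∈cone? v c w)
        where
        go : Dec (Box Δ τ ρ (point w)) → Dec (coneOf v c (point w)) → series v c (boxWeight τ) w ≡ boxSeries τ w
        go (yes box@(a , off , ≥0 , <1 , ≢0 , ca)) _ = trans
          (S.series-eval (boxWeight-vanishing τ) {a} w (λ i i∉c → off i (i∉c ∘ q⊆p∪q γ τ)) ca)
          (trans (prod-one λ i → indicator-true (inBox? τ i) (≥0 i , <1 i , off i , ≢0 i))
            (sym (boxSeries-true τ w box)))
        go (no ¬box) (no ∉cone) = trans (series-outside v c (boxWeight τ) w ∉cone)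
          (sym (boxSeries-false τ w ¬box))
        go (no ¬box) (yes (a , sa , _ , ca)) with all? (λ i → inBox? τ i (a i))
        ... | yes in-box = contradiction
          (a , (λ i → proj₁ (proj₂ (proj₂ (in-box i)))) , (λ i → proj₁ (in-box i)) , (λ i → proj₁ (proj₂ (in-box i)))
             , (λ i → proj₂ (proj₂ (proj₂ (in-box i)))) , ca) ¬box
        ... | no ¬in-box with ¬∀⟶∃¬ rays _ (λ i → inBox? τ i (a i)) ¬in-box
        ...   | i , ∉box = trans (S.series-eval (boxWeight-vanishing τ) {a} w sa ca)
          (trans (prod-zero i (indicator-false (inBox? τ i) ∉box))
            (sym (boxSeries-false τ w ¬box)))

      ∏-x^-tiling : ∏over Δ (_∈? γ) x^_ • series v c (tilingWeight τ) ≗ series v c (shiftedWeight τ γ)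
      ∏-x^-tiling = ∏over-series (_∈? γ) x^_ shift γ∪τ∈ (p⊆p∪q τ) S.x^-series
        (tilingWeight-vanishing τ) (shiftedWeight-vanishing τ γ)
        (λ i∈γ x → cong (λ f → f x) (shiftedWeight-∈ τ i∈γ))
        (λ i∉γ x _ → cong (λ f → f x) (shiftedWeight-∉ τ i∉γ))

      -- By `diff-periodic` each factor undoes the periodic extension in one coordinate. No factor
      -- acts off `c`, but the coordinate is 0 there, and at 0 the two weights agree.
      ∏-1-x^-tiling : ∏over Δ (_∈? c) 1-x^_ • series v c (tilingWeight τ) ≗ boxSeries τ
      ∏-1-x^-tiling w = trans
        (∏over-series (_∈? c) 1-x^_ diff γ∪τ∈ (λ i∈c → i∈c) S.1-x^-series
          (tilingWeight-vanishing τ) (boxWeight-vanishing τ)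
          (λ {i} _ x → sym (diff-periodic (boxWeight τ i) (boxWeight-vanishing τ i) (boxWeight-≥1 τ i) x))
          (λ {i} i∉c x x≡0 → origin i (x≡0 i∉c)) w)
        (series-boxWeight w)
        where
        origin : ∀ i {x} → x ≡ 0ℚ → boxWeight τ i x ≡ tilingWeight τ i x
        origin i refl = sym (trans (periodic-≥0 (boxWeight τ i) ℚ.≤-refl)
          (cong (boxWeight τ i) (frac-small ℚ.≤-refl (ℚ.positive⁻¹ 1ℚ))))

-- The tiling of the lattice points of the cone

_≟ˢ_ : DecidableEquality (Subset m)
_≟ˢ_ = Vec.≡-dec Bool._≟_

frac≢0⇒≢0 : ∀ {x} → frac x ≢ 0ℚ → x ≢ 0ℚ
frac≢0⇒≢0 frac≢0 refl = frac≢0 (frac-small ℚ.≤-refl (ℚ.positive⁻¹ 1ℚ))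

integral⇒≥1 : ∀ {x} → 0ℚ ≤ x → x ≢ 0ℚ → frac x ≡ 0ℚ → 0ℚ ≤ x - 1ℚ
integral⇒≥1 {x} 0≤x x≢0 frac≡0 with 1ℚ ℚ.≤? x
... | yes 1≤x = p≤q⇒0≤q-p 1≤x
... | no  1≰x = contradiction (trans (sym (frac-small 0≤x (ℚ.≰⇒> 1≰x))) frac≡0) x≢0

module _ (σ : RationalCone n) where
  open RationalCone σ using (generator)

  abstract
    contains? : ∀ w → Dec (Contains σ (point w))
    contains? w = coneOf? generator ⊤ (point w)

    G-true : ∀ w → Contains σ (point w) → G σ w ≡ 1ℤ
    G-true w = genFun-true (λ w → coneOf? generator ⊤ (point w)) w

    G-false : ∀ w → ¬ Contains σ (point w) → G σ w ≡ 0ℤ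
    G-false w = genFun-false (λ w → coneOf? generator ⊤ (point w)) w

module Identity (σ : RationalCone n) (Δ : SimplicialFan n) (subdivides : Δ Subdivides σ)
                (ρ : Subset (SimplicialFan.rays Δ)) (ρ∈ : ρ ∈ SimplicialFan.cones Δ)
                (ρ⊆max : ∀ μ → Maximal Δ μ → ρ ⊆ μ) where
  open SimplicialFan Δ
  open Fan Δ
  open WithBase ρ

  -- A maximal cone above `c` also contains `ρ`, by the assumption on `ρ`, and c ∪ ρ spans a face of
  -- it.
  ∪ρ∈ : ∀ {c} → c ∈ cones → c ∪ ρ ∈ cones
  ∪ρ∈ {c} c∈ = let μ , max , c⊆μ = maximal-above c∈ in
    face-closed (proj₁ max) λ i∈ → [ c⊆μ , ρ⊆max μ max ]′ (x∈p∪q⁻ c ρ i∈)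

  -- For γ ∈ lk τ, the expansion of the series of Box(τ, ρ), origin included, times the x^vᵢ with i
  -- ∈ γ and divided by the 1 - x^vᵢ with i ∈ γ ∪ τ.
  piece : Subset rays → Subset rays → Series n
  piece τ γ = ∏over Δ (_∈? γ) x^_ • series v (γ ∪ τ) (tilingWeight τ)

  private
    tilingWeight-nonzero : ∀ {τ i} x → tilingWeight τ i x ≢ 0ℤ → 0ℚ ≤ x × InBox τ i (frac x)
    tilingWeight-nonzero {τ} {i} x ≢0 with 0ℚ ℚ.≤? x
    ... | yes 0≤x = 0≤x , decidable-stable (inBox? τ i (frac x)) λ ∉box → ≢0 (indicator-false (inBox? τ i) ∉box)
    ... | no  _   = contradiction refl ≢0

    shiftedWeight-nonzero : ∀ {τ γ i} x → shiftedWeight τ γ i x ≢ 0ℤ →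
                            InBox τ i (frac x) × (i ∈ₛ γ → x ≢ 0ℚ)
    shiftedWeight-nonzero {τ} {γ} {i} x ≢0 with i ∈? γ
    ... | no i∉γ = proj₂ (tilingWeight-nonzero x ≢0) , λ i∈γ → contradiction i∈γ i∉γ
    ... | yes _ with tilingWeight-nonzero (x - 1ℚ) ≢0
    ...   | 0≤x-1 , in-box = subst (InBox τ i) (frac-pred x) in-box
      , λ { _ refl → ℚ.<-irrefl refl (ℚ.≤-<-trans 0≤x-1 (ℚ.negative⁻¹ (- 1ℚ))) }

  -- A lattice point Σ aᵢ vᵢ of the cone c₀ lies in the piece of (τ₀, γ₀) and in no other one:
  -- τ₀ ∖ ρ consists of the i with aᵢ fractional, and γ₀ of the i ∉ ρ with aᵢ a positive integer.
  module Locate {c₀ : Subset rays} (c₀∈ : c₀ ∈ cones) {w : Lattice n} (w∈c₀ : coneOf v c₀ (point w)) where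
    private
      a  = proj₁ w∈c₀
      sa = proj₁ (proj₂ w∈c₀)
      a≥0 = proj₁ (proj₂ (proj₂ w∈c₀))
      ca = proj₂ (proj₂ (proj₂ w∈c₀))

      τ₀? : Decidable λ i → i ∈ₛ ρ ⊎ frac (a i) ≢ 0ℚ
      τ₀? i = (i ∈? ρ) ⊎-dec ¬? (frac (a i) ℚ.≟ 0ℚ)

    τ₀ : Subset rays
    τ₀ = comprehension τ₀?

    private
      γ₀? : Decidable λ i → i ∉ τ₀ × a i ≢ 0ℚ
      γ₀? i = ¬? (i ∈? τ₀) ×-dec ¬? (a i ℚ.≟ 0ℚ)

    γ₀ : Subset rays
    γ₀ = comprehension γ₀?

    private
      nonzero⇒∈c₀ : ∀ {i} → a i ≢ 0ℚ → i ∈ₛ c₀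
      nonzero⇒∈c₀ {i} a≢0 = decidable-stable (i ∈? c₀) λ i∉c₀ → a≢0 (sa i i∉c₀)

      τ₀⊆ : τ₀ ⊆ c₀ ∪ ρ
      τ₀⊆ i∈ with ∈-comprehension⁻ τ₀? i∈
      ... | inj₁ i∈ρ = q⊆p∪q c₀ ρ i∈ρ
      ... | inj₂ frac≢0 = p⊆p∪q ρ (nonzero⇒∈c₀ (frac≢0⇒≢0 frac≢0))

      γ₀⊆ : γ₀ ⊆ c₀ ∪ ρ
      γ₀⊆ i∈ = p⊆p∪q ρ (nonzero⇒∈c₀ (proj₂ (∈-comprehension⁻ γ₀? i∈)))

      frac≡0 : ∀ {i} → i ∉ τ₀ → frac (a i) ≡ 0ℚ
      frac≡0 {i} i∉τ₀ = decidable-stable (frac (a i) ℚ.≟ 0ℚ) λ ≢0 → i∉τ₀ (∈-comprehension⁺ τ₀? (inj₂ ≢0))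

    ρ⊆τ₀ : ρ ⊆ τ₀
    ρ⊆τ₀ i∈ρ = ∈-comprehension⁺ τ₀? (inj₁ i∈ρ)

    τ₀∈ : τ₀ ∈ cones
    τ₀∈ = face-closed (∪ρ∈ c₀∈) τ₀⊆

    γ₀∈lk : InLink Δ τ₀ γ₀
    γ₀∈lk = face-closed (∪ρ∈ c₀∈) γ₀⊆
          , ∩≡⊥⁺ (proj₁ ∘ ∈-comprehension⁻ γ₀?)
          , face-closed (∪ρ∈ c₀∈) (λ i∈ → [ γ₀⊆ , τ₀⊆ ]′ (x∈p∪q⁻ γ₀ τ₀ i∈))

    private
      series-at : ∀ {τ γ} → InLink Δ τ γ → (∀ i → i ∉ γ ∪ τ → a i ≡ 0ℚ) →
                  piece τ γ w ≡ prod λ i → shiftedWeight τ γ i (a i)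
      series-at {τ} {γ} (_ , _ , γ∪τ∈) supported = trans (∏-x^-tiling γ∪τ∈ w)
        (Simplicial.series-eval v (γ ∪ τ) (simplicial γ∪τ∈) (shiftedWeight-vanishing τ γ) {a} w supported ca)

    piece-located : piece τ₀ γ₀ w ≡ 1ℤ
    piece-located = trans (series-at γ₀∈lk supported) (prod-one one)
      where
      supported : ∀ i → i ∉ γ₀ ∪ τ₀ → a i ≡ 0ℚ
      supported i i∉ = decidable-stable (a i ℚ.≟ 0ℚ) λ a≢0 →
        i∉ (p⊆p∪q τ₀ (∈-comprehension⁺ γ₀? ((λ i∈τ₀ → i∉ (q⊆p∪q γ₀ τ₀ i∈τ₀)) , a≢0)))
      in-box : ∀ i → InBox τ₀ i (frac (a i))
      in-box i = 0≤frac (a i) , frac<1 (a i) , frac≡0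
        , λ i∈τ₀ i∉ρ → [ (λ i∈ρ → contradiction i∈ρ i∉ρ) , (λ ≢0 → ≢0) ]′ (∈-comprehension⁻ τ₀? i∈τ₀)
      one : ∀ i → shiftedWeight τ₀ γ₀ i (a i) ≡ 1ℤ
      one i with i ∈? γ₀
      ... | no _ = trans (periodic-≥0 (boxWeight τ₀ i) (a≥0 i)) (indicator-true (inBox? τ₀ i) (in-box i))
      -- Here aᵢ is a positive integer, so aᵢ - 1 is still non-negative and has the same fractional
      -- part.
      ... | yes i∈γ₀ = trans (periodic-≥0 (boxWeight τ₀ i) (integral⇒≥1 (a≥0 i) a≢0 (frac≡0 i∉τ₀)))
        (trans (cong (boxWeight τ₀ i) (frac-pred (a i))) (indicator-true (inBox? τ₀ i) (in-box i)))
        where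
        i∉τ₀ = proj₁ (∈-comprehension⁻ γ₀? i∈γ₀)
        a≢0 = proj₂ (∈-comprehension⁻ γ₀? i∈γ₀)

    -- If w lies in the cone γ ∪ τ, its coordinates there are again the aᵢ. Were all factors of the
    -- product nonzero, the fractional parts would recover `τ` as `τ₀` and the remaining nonzero
    -- coordinates `γ` as `γ₀`; so some factor is 0.
    piece-elsewhere : ∀ {τ γ} → ρ ⊆ τ → InLink Δ τ γ → ¬ (τ ≡ τ₀ × γ ≡ γ₀) → piece τ γ w ≡ 0ℤ
    piece-elsewhere {τ} {γ} ρ⊆τ γ∈lk@(_ , γ∩τ≡⊥ , γ∪τ∈) elsewhere = go (∈cone? v (γ ∪ τ) w)
      where
      go : Dec (coneOf v (γ ∪ τ) (point w)) → piece τ γ w ≡ 0ℤ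
      go (no ∉cone) = trans (∏-x^-tiling γ∪τ∈ w) (series-outside v (γ ∪ τ) (shiftedWeight τ γ) w ∉cone)
      go (yes ∈cone@(b , sb , _)) = conclude
        where
        supported : ∀ i → i ∉ γ ∪ τ → a i ≡ 0ℚ
        supported i i∉ = trans (coordinates-agree c₀∈ γ∪τ∈ w∈c₀ ∈cone i) (sb i i∉)
        nonzero? : Decidable λ i → shiftedWeight τ γ i (a i) ≢ 0ℤ
        nonzero? i = ¬? (shiftedWeight τ γ i (a i) ℤ.≟ 0ℤ)
        located : (∀ i → shiftedWeight τ γ i (a i) ≢ 0ℤ) → τ ≡ τ₀ × γ ≡ γ₀
        located ≢0 = ⊆-antisym τ⊆τ₀ τ₀⊆τ , ⊆-antisym γ⊆γ₀ γ₀⊆γ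
          where
          box : ∀ i → InBox τ i (frac (a i))
          box i = proj₁ (shiftedWeight-nonzero {τ} {γ} (a i) (≢0 i))
          τ⊆τ₀ : τ ⊆ τ₀
          -- On `ρ` the box allows an integral coordinate, so membership there comes from the
          -- definition of `τ₀` instead.
          τ⊆τ₀ {i} i∈τ with i ∈? ρ
          ... | yes i∈ρ = ρ⊆τ₀ i∈ρ
          ... | no  i∉ρ = ∈-comprehension⁺ τ₀? (inj₂ (proj₂ (proj₂ (proj₂ (box i))) i∈τ i∉ρ))
          τ₀⊆τ : τ₀ ⊆ τ
          τ₀⊆τ {i} i∈τ₀ with ∈-comprehension⁻ τ₀? i∈τ₀
          ... | inj₁ i∈ρ    = ρ⊆τ i∈ρ
          ... | inj₂ frac≢0 = decidable-stable (i ∈? τ) λ i∉τ → frac≢0 (proj₁ (proj₂ (proj₂ (box i))) i∉τ)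
          γ⊆γ₀ : γ ⊆ γ₀
          γ⊆γ₀ {i} i∈γ = ∈-comprehension⁺ γ₀?
            ((λ i∈τ₀ → ∩≡⊥⁻ γ∩τ≡⊥ i∈γ (τ₀⊆τ i∈τ₀)) , proj₂ (shiftedWeight-nonzero {τ} {γ} (a i) (≢0 i)) i∈γ)
          γ₀⊆γ : γ₀ ⊆ γ
          γ₀⊆γ {i} i∈γ₀ = decidable-stable (i ∈? γ) λ i∉γ →
            let i∉τ₀ , a≢0 = ∈-comprehension⁻ γ₀? i∈γ₀ in
            a≢0 (supported i λ i∈ → [ i∉γ , i∉τ₀ ∘ τ⊆τ₀ ]′ (x∈p∪q⁻ γ τ i∈))
        conclude : piece τ γ w ≡ 0ℤ
        conclude with all? nonzero?
        ... | yes ≢0 = contradiction (located ≢0) elsewhere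
        ... | no ¬≢0 with ¬∀⟶∃¬ rays _ nonzero? ¬≢0
        ...   | i , ¬¬≡0 = trans (series-at γ∈lk supported)
          (prod-zero i (decidable-stable (shiftedWeight τ γ i (a i) ℤ.≟ 0ℤ) ¬¬≡0))

  link : Subset rays → List (Subset rays)
  link τ = filter (inLink? Δ τ) cones

  above : List (Subset rays)
  above = filter (ρ ⊆?_) cones

  link⁻ : ∀ {τ γ} → γ ∈ link τ → InLink Δ τ γ
  link⁻ {τ} = proj₂ ∘ ∈-filter⁻ (inLink? Δ τ) {xs = cones}

  above⁻ : ∀ {τ} → τ ∈ above → τ ∈ cones × ρ ⊆ τ
  above⁻ = ∈-filter⁻ (ρ ⊆?_) {xs = cones}

  pieces : Subset rays → Series n
  pieces τ = ∑ (map (piece τ) (link τ))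

  -- Outside σ every piece is 0, because its cone γ ∪ τ lies in σ. Inside, `Locate` gives the one
  -- pair that contributes, and both sums collapse to it.
  tiling : G σ ≗ ∑ (map pieces above)
  tiling w = go (contains? σ w)
    where
    open Equivalence
    go : Dec (Contains σ (point w)) → G σ w ≡ ∑ (map pieces above) w
    go (no ∉σ) = trans (G-false σ w ∉σ) (sym (∑-zero pieces above w λ {τ} _ → ∑-zero (piece τ) (link τ) w λ {γ} γ∈ →
      let γ∪τ∈ = proj₂ (proj₂ (link⁻ {τ} γ∈)) in
      trans (∏-x^-tiling {τ} {γ} γ∪τ∈ w) (series-outside v (γ ∪ τ) (shiftedWeight τ γ) w λ ∈cone →
        ∉σ (from (subdivides (point w)) (γ ∪ τ , γ∪τ∈ , ∈cone)))))
    go (yes ∈σ) = begin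
      G σ w                            ≡⟨ G-true σ w ∈σ ⟩
      1ℤ                               ≡⟨ piece-located ⟨
      piece τ₀ γ₀ w                    ≡⟨ ∑-single (piece τ₀) w (filter⁺ (inLink? Δ τ₀) unique)
                                            (∈-filter⁺ (inLink? Δ τ₀) (proj₁ γ₀∈lk) γ₀∈lk)
                                            (λ γ∈ γ≢γ₀ → piece-elsewhere ρ⊆τ₀ (link⁻ {τ₀} γ∈) (γ≢γ₀ ∘ proj₂)) ⟨
      pieces τ₀ w                      ≡⟨ ∑-single pieces w (filter⁺ (ρ ⊆?_) unique)
                                            (∈-filter⁺ (ρ ⊆?_) τ₀∈ ρ⊆τ₀)
                                            (λ {τ} τ∈ τ≢τ₀ → ∑-zero (piece τ) (link τ) w λ γ∈ →
                                              piece-elsewhere (proj₂ (above⁻ τ∈)) (link⁻ {τ} γ∈) (τ≢τ₀ ∘ proj₁)) ⟨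
      ∑ (map pieces above) w           ∎
      where
      open ≡-Reasoning
      located = to (subdivides (point w)) ∈σ
      open Locate (proj₁ (proj₂ located)) {w} (proj₂ (proj₂ located))

  -- Collecting the numerators

  allRays : Laurent n
  allRays = ∏ (map (λ i → 1-x^ (v i)) (allFin rays))

  outside : Subset rays → Laurent n
  outside τ = ∏over Δ (λ j → ¬? (rayOfStar? Δ τ j)) 1-x^_

  linkFactor : Subset rays → Subset rays → Laurent n
  linkFactor τ γ = ∏over Δ (λ j → rayOfLink? Δ τ j ×-dec ¬? (j ∈? γ)) 1-x^_

  -- Agrees by definition with the summand of `H`, which is local there.
  linkTerm : Subset rays → Subset rays → Laurent n
  linkTerm τ γ = ∏over Δ (_∈? γ) x^_ · linkFactor τ γ

  -- The factors for γ ∪ τ clear the denominators of the piece. The other factors are those of the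
  -- link term and those outside the star.
  piece-numerator : ∀ {τ γ} → τ ∈ cones → InLink Δ τ γ →
                    allRays • piece τ γ ≗ linkTerm τ γ • (outside τ • boxSeries τ)
  piece-numerator {τ} {γ} τ∈ γ∈lk w = begin
    (allRays • (xγ • f)) w                                    ≡⟨ •-comm allRays xγ f w ⟩
    (xγ • (allRays • f)) w                                    ≡⟨ •-cong xγ (∏-partition
                                                                  (λ j → rayOfLink? Δ τ j ×-dec ¬? (j ∈? γ))
                                                                  (λ j → ¬? (rayOfStar? Δ τ j)) (_∈? γ ∪ τ)
                                                                  (ray-trichotomy τ∈ γ∈lk) (λ i → 1-x^ (v i))
                                                                  (allFin rays) f) w ⟩
    (xγ • (linkFactor τ γ • (outside τ • (cone • f)))) w      ≡⟨ •-cong xγ (•-cong (linkFactor τ γ) (•-cong (outside τ)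
                                                                  (∏-1-x^-tiling (proj₂ (proj₂ γ∈lk))))) w ⟩
    (xγ • (linkFactor τ γ • (outside τ • boxSeries τ))) w     ≡⟨ •-· xγ (linkFactor τ γ) (outside τ • boxSeries τ) w ⟨
    (linkTerm τ γ • (outside τ • boxSeries τ)) w              ∎
    where
    open ≡-Reasoning
    xγ = ∏over Δ (_∈? γ) x^_
    cone = ∏over Δ (_∈? γ ∪ τ) 1-x^_
    f = series v (γ ∪ τ) (tilingWeight τ)

  pieces-numerator : ∀ {τ} → τ ∈ cones → allRays • pieces τ ≗ (H Δ τ · outside τ) • boxSeries τ
  pieces-numerator {τ} τ∈ w = begin
    (allRays • pieces τ) w
      ≡⟨ •-∑ allRays (piece τ) (link τ) w ⟩
    ∑ (map (λ γ → allRays • piece τ γ) (link τ)) w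
      ≡⟨ ∑-cong (λ γ → allRays • piece τ γ) (λ γ → linkTerm τ γ • (outside τ • boxSeries τ)) (link τ)
           (λ γ∈ → piece-numerator τ∈ (link⁻ {τ} γ∈)) w ⟩
    ∑ (map (λ γ → linkTerm τ γ • (outside τ • boxSeries τ)) (link τ)) w
      ≡⟨ concat-• (linkTerm τ) (outside τ • boxSeries τ) (link τ) w ⟨
    (H Δ τ • (outside τ • boxSeries τ)) w
      ≡⟨ •-· (H Δ τ) (outside τ) (boxSeries τ) w ⟨
    ((H Δ τ · outside τ) • boxSeries τ) w ∎
    where open ≡-Reasoning

  -- The origin

  δ : Series n
  δ = genFun (_≟ᴺ 0ᴺ)

  -- The part of the box series that `B` omits, defined for every `τ` so that it can be summed over
  -- the same cones as `B`.
  originSeries : Subset rays → Series n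
  originSeries τ w with τ ≟ˢ ρ
  ... | yes _ = δ w
  ... | no  _ = 0ℤ

  originSeries-base : originSeries ρ ≗ δ
  originSeries-base w with ρ ≟ˢ ρ
  ... | yes _   = refl
  ... | no  ρ≢ρ = contradiction refl ρ≢ρ

  originSeries-other : ∀ {τ} → τ ≢ ρ → originSeries τ ≗ λ _ → 0ℤ
  originSeries-other {τ} τ≢ρ w with τ ≟ˢ ρ
  ... | yes τ≡ρ = contradiction τ≡ρ τ≢ρ
  ... | no  _   = refl

  point-0ᴺ : ∀ k → point {n} 0ᴺ k ≡ 0ℚ
  point-0ᴺ k = cong (ℚ._/ 1) (Vec.lookup-replicate k ℤ.0ℤ)

  origin∈Box : Box Δ ρ ρ (point 0ᴺ)
  origin∈Box = (λ _ → 0ℚ) , (λ _ _ → refl) , (λ _ → ℚ.≤-refl) , (λ _ → ℚ.positive⁻¹ 1ℚ)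
    , (λ _ i∈ρ i∉ρ → contradiction i∈ρ i∉ρ)
    , λ k → trans (sum-0* (λ i → point (v i) k)) (sym (point-0ᴺ k))

  -- By independence the origin has only zero coordinates, whereas the box requires nonzero ones on
  -- the rays of `τ` off `ρ`. So there would be no such rays.
  origin∉Box : ∀ {τ} → τ ∈ cones → ρ ⊆ τ → τ ≢ ρ → ¬ Box Δ τ ρ (point 0ᴺ)
  origin∉Box {τ} τ∈ ρ⊆τ τ≢ρ (a , sa , _ , _ , ≢0 , ca) = τ≢ρ (⊆-antisym τ⊆ρ ρ⊆τ)
    where
    τ⊆ρ : τ ⊆ ρ
    τ⊆ρ {i} i∈τ = decidable-stable (i ∈? ρ) λ i∉ρ → ≢0 i i∈τ i∉ρ
      (simplicial τ∈ a sa (λ k → trans (ca k) (point-0ᴺ k)) i)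

  boxSeries-split : ∀ {τ} → τ ∈ cones → ρ ⊆ τ → boxSeries τ ≗ B Δ τ ρ ⊕ originSeries τ
  boxSeries-split {τ} τ∈ ρ⊆τ w = go (w ≟ᴺ 0ᴺ) (τ ≟ˢ ρ) (inBoxSet? τ w)
    where
    δ≡0 : w ≢ 0ᴺ → originSeries τ w ≡ 0ℤ
    δ≡0 w≢0 with τ ≟ˢ ρ
    ... | yes _ = genFun-false (_≟ᴺ 0ᴺ) w w≢0
    ... | no  _ = refl
    go : Dec (w ≡ 0ᴺ) → Dec (τ ≡ ρ) → Dec (Box Δ τ ρ (point w)) → boxSeries τ w ≡ (B Δ τ ρ ⊕ originSeries τ) w
    go (no w≢0) _ (yes box) = trans (boxSeries-true τ w box)
      (sym (cong₂ ℤ._+_ (B-true τ w box w≢0) (δ≡0 w≢0)))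
    go (no w≢0) _ (no ¬box) = trans (boxSeries-false τ w ¬box)
      (sym (cong₂ ℤ._+_ (B-false τ w (¬box ∘ proj₁)) (δ≡0 w≢0)))
    go (yes refl) (yes refl) _ = trans (boxSeries-true ρ 0ᴺ origin∈Box)
      (sym (cong₂ ℤ._+_ (B-false ρ 0ᴺ λ (_ , ≢0) → ≢0 refl)
        (trans (originSeries-base 0ᴺ) (genFun-true (_≟ᴺ 0ᴺ) (0ᴺ {n}) refl))))
    go (yes refl) (no τ≢ρ) _ = trans (boxSeries-false τ 0ᴺ (origin∉Box τ∈ ρ⊆τ τ≢ρ))
      (sym (cong₂ ℤ._+_ (B-false τ 0ᴺ λ (_ , ≢0) → ≢0 refl) (originSeries-other τ≢ρ 0ᴺ)))

  -- Each ray spans a cone together with `ρ` by `∪ρ∈`, hence lies in Star ρ, and the product is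
  -- empty.
  outside-base : outside ρ ≡ x^ 0ᴺ
  outside-base = cong (λ js → ∏ (map (λ j → 1-x^ (v j)) js))
    (filter-none (λ j → ¬? (rayOfStar? Δ ρ j)) {xs = allFin rays} (All.tabulate λ {j} _ ¬star →
      ¬star (rayOfStar⁺ ρ∈ (∪ρ∈ (ray∈ j)) (q⊆p∪q ⁅ j ⁆ ρ) (p⊆p∪q ρ (x∈⁅x⁆ j)))))

  numerator : Subset rays → Laurent n
  numerator τ = H Δ τ · outside τ

  -- Only τ = ρ has the origin in its box, and its factor for the rays outside the star is 1.
  origin-total : ∑ (map (λ τ → numerator τ • originSeries τ) above) ≗ coeff (H Δ ρ)
  origin-total w = begin
    ∑ (map (λ τ → numerator τ • originSeries τ) above) w
      ≡⟨ ∑-single (λ τ → numerator τ • originSeries τ) w (filter⁺ (ρ ⊆?_) unique)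
           (∈-filter⁺ (ρ ⊆?_) ρ∈ ⊆-refl)
           (λ {τ} _ τ≢ρ → trans (•-cong (numerator τ) (originSeries-other τ≢ρ) w) (•-zero (numerator τ) w)) ⟩
    (numerator ρ • originSeries ρ) w      ≡⟨ •-cong (numerator ρ) originSeries-base w ⟩
    (numerator ρ • δ) w                   ≡⟨ •-· (H Δ ρ) (outside ρ) δ w ⟩
    (H Δ ρ • (outside ρ • δ)) w           ≡⟨ cong (λ p → (H Δ ρ • (p • δ)) w) outside-base ⟩
    (H Δ ρ • ((x^ 0ᴺ) • δ)) w             ≡⟨ •-cong (H Δ ρ) (x^0-• δ) w ⟩
    coeff (H Δ ρ) w                       ∎
    where open ≡-Reasoning

  identity : allRays • G σ ≗ coeff (H Δ ρ) ⊕ ∑ (map (λ τ → numerator τ • B Δ τ ρ) above)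
  identity w = begin
    (allRays • G σ) w
      ≡⟨ •-cong allRays tiling w ⟩
    (allRays • ∑ (map pieces above)) w
      ≡⟨ •-∑ allRays pieces above w ⟩
    ∑ (map (λ τ → allRays • pieces τ) above) w
      ≡⟨ ∑-cong (λ τ → allRays • pieces τ) (λ τ → N τ ⊕ D τ) above (λ τ∈ → split (above⁻ τ∈)) w ⟩
    ∑ (map (λ τ → N τ ⊕ D τ) above) w
      ≡⟨ ∑-⊕ N D above w ⟩
    ∑ (map N above) w ℤ.+ ∑ (map D above) w
      ≡⟨ cong (λ r → ∑ (map N above) w ℤ.+ r) (origin-total w) ⟩
    ∑ (map N above) w ℤ.+ coeff (H Δ ρ) w
      ≡⟨ ℤ.+-comm (∑ (map N above) w) (coeff (H Δ ρ) w) ⟩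
    coeff (H Δ ρ) w ℤ.+ ∑ (map N above) w ∎
    where
    open ≡-Reasoning
    N D : Subset rays → Series n
    N τ = numerator τ • B Δ τ ρ
    D τ = numerator τ • originSeries τ
    split : ∀ {τ} → τ ∈ cones × ρ ⊆ τ → allRays • pieces τ ≗ N τ ⊕ D τ
    split {τ} (τ∈ , ρ⊆τ) w = begin
      (allRays • pieces τ) w                              ≡⟨ pieces-numerator τ∈ w ⟩
      (numerator τ • boxSeries τ) w                       ≡⟨ •-cong (numerator τ) (boxSeries-split τ∈ ρ⊆τ) w ⟩
      (numerator τ • (B Δ τ ρ ⊕ originSeries τ)) w        ≡⟨ •-⊕ (numerator τ) (B Δ τ ρ) (originSeries τ) w ⟩
      (N τ ⊕ D τ) w                                       ∎

open SimplicialFan using (rays; v; cones)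

theorem1p2 : (n : ℕ) (σ : RationalCone n) (Δ : SimplicialFan n) →
    StronglyConvex σ → Δ Subdivides σ →
    (ρ : Subset (rays Δ)) → ρ ∈ cones Δ → (∀ μ → Maximal Δ μ → ρ ⊆ μ) →
    ∏ (map (λ i → 1-x^ (v Δ i)) (allFin (rays Δ))) • G σ
    ≗
    coeff (H Δ ρ)
    ⊕ ∑ (map (λ τ → (H Δ τ · ∏over Δ (λ j → ¬? (rayOfStar? Δ τ j)) 1-x^_) • B Δ τ ρ)
    (filter (ρ ⊆?_) (cones Δ)))
theorem1p2 n σ Δ _ subdivides ρ ρ∈ ρ⊆max = Identity.identity σ Δ subdivides ρ ρ∈ ρ⊆max
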